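{- Let $n\ge 2$. For every $j=1,\ldots,n-1$, the number $v^n_j$ of plane geometric graphs on $n$ points in convex position whose root vertex has visibility degree $j-1$ is $$v_{j}^{n} = \frac{j}{n-1}2^{n-1-j}\sum_{k=j}^{n-1}\binom{n-1}{k}\binom{n+k-j-2}{k-j}(-1)^{n-1-k}2^{k}.$$
   Context: A geometric graph on a finite point set $\mathcal S\subseteq\mathbb R^2$ has vertex set $\mathcal S$ and edges that are straight-line segments with endpoints in $\mathcal S$; it is plane if no two edges intersect except at common endpoints. The vertices are points $p_1,\dots,p_n$ in convex position labelled in counter-clockwise order, with root vertex $p_n$. Two vertices are visible (from each other) if the line segment connecting them does not intersect the interior of any edge of the graph. The visibility degree of the root vertex $p_n$ is the number of vertices visible from an additional vertex $p_{n+1}$ inserted between $p_n$ and $p_1$ in convex position, minus $2$. -}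

module Defs where

open import Data.Bool.Base using (Bool; true; false)
open import Data.Fin.Base using (Fin) renaming (_<_ to _<ᶠ_)
open import Data.Integer.Base as ℤ using (ℤ; +_; 0ℤ; -1ℤ)
open import Data.List.Base using (List; length; map; foldr; upTo)
open import Data.List.Membership.Propositional using (_∈_)
open import Data.List.Relation.Unary.Unique.Propositional using (Unique)
open import Data.Nat.Base as ℕ using (ℕ; suc; _∸_; >-nonZero)
open import Data.Nat.Combinatorics using (_C_)
open import Data.Nat.Properties using (m<n⇒0<n∸m)
open import Data.Product.Base using (_×_; _,_; ∃-syntax)
open import Data.Rational.Base as ℚ using (ℚ)
open import Data.Sum.Base using (_⊎_)
open import Data.Vec.Base using (Vec; lookup)
open import Algebra.Bundles using (CommutativeRing)
open import Function.Bundles using (_⇔_)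
open import Level using (Level; _⊔_) renaming (suc to lsuc)
open import Relation.Binary.Core using (Rel)
open import Relation.Binary.PropositionalEquality.Core using (_≡_)
open import Relation.Binary.Structures using (IsStrictTotalOrder)
open import Relation.Nullary.Negation.Core using (¬_)
import Relation.Binary.Construct.StrictToNonStrict as NonStrict

HasCardinality : ∀ {a ℓ} {A : Set a} → (A → Set ℓ) → ℕ → Set (a ⊔ ℓ)
HasCardinality {A = A} P m =
  ∃[ xs ] Unique xs × (∀ (x : A) → x ∈ xs ⇔ P x) × length xs ≡ m

-- The library has no real numbers. The coordinates of points range over an
-- arbitrary totally ordered field, of which ℝ is (classically) an instance.
record OrderedField c ℓ₁ ℓ₂ : Set (lsuc (c ⊔ ℓ₁ ⊔ ℓ₂)) where
  field
    commutativeRing : CommutativeRing c ℓ₁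
  open CommutativeRing commutativeRing public
  infix 4 _<_
  field
    _<_                : Rel Carrier ℓ₂
    isStrictTotalOrder : IsStrictTotalOrder _≈_ _<_
    0≉1                : ¬ (0# ≈ 1#)
    inverse            : ∀ x → ¬ (x ≈ 0#) → ∃[ y ] x * y ≈ 1#
    +-monoˡ-<          : ∀ {x y} z → x < y → x + z < y + z
    *-positive         : ∀ {x y} → 0# < x → 0# < y → 0# < x * y
  open NonStrict _≈_ _<_ public using (_≤_)

-- A finite simple graph on Fin n. The proofs are irrelevant, so two graphs
-- are propositionally equal as soon as they have the same edges.
record Graph (n : ℕ) : Set where
  constructor mkGraph
  field
    adjacency    : Vec (Vec Bool n) n
    .symmetric   : ∀ i j → lookup (lookup adjacency i) j ≡ lookup (lookup adjacency j) i
    .irreflexive : ∀ i → lookup (lookup adjacency i) i ≡ false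

  Edge : Fin n → Fin n → Set
  Edge i j = lookup (lookup adjacency i) j ≡ true

open Graph public using (Edge)

module Geometry {c ℓ₁ ℓ₂} (F : OrderedField c ℓ₁ ℓ₂) where
  open OrderedField F

  Point : Set c
  Point = Carrier × Carrier

  infix 4 _≈ₚ_
  _≈ₚ_ : Point → Point → Set ℓ₁
  (x₁ , y₁) ≈ₚ (x₂ , y₂) = x₁ ≈ x₂ × y₁ ≈ y₂

  pointAt : Carrier → Point → Point → Point
  pointAt t (x₁ , y₁) (x₂ , y₂) =
    (1# - t) * x₁ + t * x₂ , (1# - t) * y₁ + t * y₂

  OnSegment : Point → Point → Point → Set (c ⊔ ℓ₁ ⊔ ℓ₂)
  OnSegment a b z = ∃[ t ] 0# ≤ t × t ≤ 1# × z ≈ₚ pointAt t a b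

  InSegmentInterior : Point → Point → Point → Set (c ⊔ ℓ₁ ⊔ ℓ₂)
  InSegmentInterior a b z = ∃[ t ] 0# < t × t < 1# × z ≈ₚ pointAt t a b

  -- Twice the signed area of the triangle a b d is positive, that is,
  -- a, b, d are in counter-clockwise order and not collinear.
  CounterClockwise : Point → Point → Point → Set ℓ₂
  CounterClockwise (x₁ , y₁) (x₂ , y₂) (x₃ , y₃) =
    0# < (x₂ - x₁) * (y₃ - y₁) - (x₃ - x₁) * (y₂ - y₁)

  -- For at least three points: they are in convex position, listed in
  -- counter-clockwise order along their convex hull.
  ConvexPosition : ∀ {n} → Vec Point n → Set ℓ₂
  ConvexPosition p = ∀ {i j k} → i <ᶠ j → j <ᶠ k →
    CounterClockwise (lookup p i) (lookup p j) (lookup p k)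

  module _ {n : ℕ} (p : Vec Point n) (G : Graph n) where

    SameEdge : (i j k l : Fin n) → Set
    SameEdge i j k l = (i ≡ k × j ≡ l) ⊎ (i ≡ l × j ≡ k)

    CommonEndpoint : (i j k l : Fin n) → Point → Set ℓ₁
    CommonEndpoint i j k l z =
      ∃[ m ] (m ≡ i ⊎ m ≡ j) × (m ≡ k ⊎ m ≡ l) × z ≈ₚ lookup p m

    Plane : Set (c ⊔ ℓ₁ ⊔ ℓ₂)
    Plane = ∀ i j k l → Edge G i j → Edge G k l → ¬ SameEdge i j k l →
      ∀ z → OnSegment (lookup p i) (lookup p j) z →
            OnSegment (lookup p k) (lookup p l) z →
            CommonEndpoint i j k l z

    Visible : Point → Point → Set (c ⊔ ℓ₁ ⊔ ℓ₂)
    Visible a b = ∀ i j → Edge G i j →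
      ¬ (∃[ z ] OnSegment a b z × InSegmentInterior (lookup p i) (lookup p j) z)

    -- q is the additional vertex inserted between the last and the first
    -- point of p. The "minus 2" in the definition of the visibility degree
    -- is moved to the other side to avoid truncated subtraction.
    HasRootVisibilityDegree : Point → ℕ → Set (c ⊔ ℓ₁ ⊔ ℓ₂)
    HasRootVisibilityDegree q d =
      HasCardinality (λ (i : Fin n) → Visible q (lookup p i)) (d ℕ.+ 2)

Σ[_≤k≤_] : ℕ → ℕ → (ℕ → ℤ) → ℤ
Σ[ a ≤k≤ b ] f = foldr ℤ._+_ 0ℤ (map (λ i → f (a ℕ.+ i)) (upTo (suc b ∸ a)))

-- For 1 ≤ j ≤ n - 1 no subtraction of naturals below is truncated.
visibilityFormula : (n j : ℕ) → 2 ℕ.≤ n → ℚ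
visibilityFormula n j 2≤n =
  (+ j ℚ./ (n ∸ 1)) {{>-nonZero (m<n⇒0<n∸m 2≤n)}}
    ℚ.* ((+ (2 ℕ.^ (n ∸ 1 ∸ j)) ℤ.* sum) ℚ./ 1)
  where
  sum : ℤ
  sum = Σ[ j ≤k≤ n ∸ 1 ] λ k →
    + ((n ∸ 1) C k) ℤ.* + ((n ℕ.+ k ∸ j ∸ 2) C (k ∸ j))
      ℤ.* -1ℤ ℤ.^ (n ∸ 1 ∸ k) ℤ.* + (2 ℕ.^ k)

{-# OPTIONS --safe #-}
module Submission where

-- An edge separates the additional vertex from exactly the vertices strictly
-- between its endpoints, so a vertex is visible iff no edge covers it. A
-- noncrossing graph on n + 1 vertices arises uniquely from one on n vertices by
-- adding a new first vertex joined to a subset of the uncovered vertices, and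
-- this hides the uncovered vertices before the last new neighbour. Writing v N j
-- for the paper's number with N = n - 1, the resulting succession rule becomes
-- v (N+1) j = 2 v (N+1) (j+1) + 2 v N (j-1) - 2 v N j.
-- Writing ψ = (2 - y) / (1 - y), its solution is
-- N v N j = j 2ᴺ⁻ʲ [yᴺ⁻ʲ] ψᴺ, by the relations (1 - y) ψᴺ⁺¹ = (2 - y) ψᴺ and
-- N ψᴺ⁺¹ = (2 - y) (ψᴺ)′ + N ψᴺ; expanding ψᴺ as a product gives the formula.

open import Algebra.Bundles using (CommutativeRing)
import Algebra.Solver.Ring
open import Algebra.Solver.Ring.AlmostCommutativeRing
  using (fromCommutativeRing; _-Raw-AlmostCommutative⟶_)
open import Data.Bool.Base using (Bool; true; false; _∧_; _∨_; not; if_then_else_)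
import Data.Bool.Properties as Bool
open import Data.Empty using (⊥; ⊥-elim)
open import Data.Fin.Base as Fin using (Fin; zero; suc; inject₁; fromℕ) renaming (_<_ to _<ᶠ_)
import Data.Fin.Properties as Fin
open import Data.Fin.Subset using (∣_∣)
open import Data.Fin.Subset.Properties using (∣p∣≤n)
open import Data.Integer.Base as ℤ using (ℤ; +_; -[1+_]; 0ℤ; 1ℤ; -1ℤ)
import Data.Integer.Properties as ℤ
open import Data.Integer.Solver renaming (module +-*-Solver to ℤ-Solver)
open import Data.List.Base
  using (List; []; _∷_; [_]; map; _++_; concatMap; length; filter; foldr; applyUpTo; upTo)
open import Data.List.Membership.Propositional using (_∈_; find)
open import Data.List.Membership.Propositional.Properties
  using (∈-map⁺; ∈-map⁻; ∈-++⁺ˡ; ∈-++⁺ʳ; ∈-++⁻; ∈-concatMap⁺; ∈-concatMap⁻; ∈-filter⁺; ∈-filter⁻)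
open import Data.List.Membership.Propositional.Properties.WithK using (unique∧set⇒bag)
open import Data.List.Properties using (map-++; map-cong; map-∘; map-upTo; length-map)
open import Data.List.Relation.Binary.BagAndSetEquality using (∼bag⇒↭)
open import Data.List.Relation.Binary.Permutation.Propositional.Properties using (↭-length)
open import Data.List.Relation.Unary.All as All using ([]; _∷_)
import Data.List.Relation.Unary.All.Properties as All
import Data.List.Relation.Unary.AllPairs as AllPairs
import Data.List.Relation.Unary.AllPairs.Properties as AllPairs
open import Data.List.Relation.Unary.Any as Any using (here; there)
open import Data.List.Relation.Unary.Unique.Propositional using (Unique; []; _∷_)
import Data.List.Relation.Unary.Unique.Propositional.Properties as Unique
open import Data.Maybe.Base as Maybe using (Maybe)
open import Data.Nat.Base as ℕ using (ℕ; zero; suc; s≤s; z≤n)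
open import Data.Nat.Combinatorics using (_C_; nCn≡1; nCk+nC[k+1]≡[n+1]C[k+1])
open import Data.Nat.ListAction using (sum)
open import Data.Nat.ListAction.Properties using (sum-++)
import Data.Nat.Properties as ℕ
open import Data.Nat.Solver renaming (module +-*-Solver to ℕ-Solver)
open import Data.Product.Base using (_×_; _,_; ∃-syntax; proj₁; proj₂)
open import Data.Rational.Base as ℚ using (_/_)
import Data.Rational.Properties as ℚ
open import Data.Rational.Unnormalised.Base using (mkℚᵘ; *≡*)
import Data.Rational.Unnormalised.Properties as ℚᵘ
import Data.Sign.Base as Sign
open import Data.Sum.Base using (_⊎_; inj₁; inj₂; swap)
open import Data.Vec.Base as Vec using (Vec; []; _∷_; lookup; head; tail; zipWith; _∷ʳ_)
import Data.Vec.Properties as Vec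
open import Function.Base using (_∘_)
open import Function.Bundles using (_⇔_; mk⇔; Equivalence)
open import Relation.Binary.Definitions using (tri<; tri≈; tri>)
open import Relation.Binary.PropositionalEquality as ≡ using (_≡_; _≢_; module ≡-Reasoning)
open import Relation.Binary.Structures using (IsStrictTotalOrder)
open import Relation.Nullary.Decidable.Core using (recompute; dec⇒maybe; yes; no)
open import Relation.Nullary.Negation.Core using (¬_; contradiction)

open import Defs

-- Ring solving with integer coefficients

-- The series ψ comes from the kernel of the succession rule. Seeking solutions v N j = [xᴺ] fʲ
-- turns the rule into f = 2 f² + 2 x - 2 x f, and with y = 2 f this reads y = 2 x ψ(y). Lagrange
-- inversion predicts the answer: 2ᴺ comes from the powers of 2 ψ, and 2⁻ʲ from fʲ = (y / 2)ʲ. No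
-- series is inverted below. The prediction is verified by induction, with the differential relation
-- for ψ in place of Lagrange's theorem, so that only integer sequences and polynomial identities
-- occur. The rule has finitely many terms because the numbers of extensions of a fixed graph form
-- essentially a geometric progression with ratio 2 in the new number of uncovered vertices;
-- subtracting twice the next count cancels all but the ends. On the geometric side, every claim
-- about segments is reduced to the signs of orientation determinants, which satisfy polynomial
-- identities valid over any ordered field.

module IntegerCoefficients {c ℓ} (R : CommutativeRing c ℓ) where
  open CommutativeRing R
  open import Algebra.Properties.Ring ring
  open import Algebra.Properties.Semiring.Mult.TCOptimised semiring renaming (_×_ to _·_)
  open import Relation.Binary.Reasoning.Setoid setoid

  -- Integer coefficients compute, so the solver can recognise cancellations that are opaque among
  -- elements of an abstract ring. The optimised multiple makes `1 · 1#` reduce to `1#`, hence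
  -- `con (+ 1)` stands for `1#` on the nose.
  fromℤ : ℤ → Carrier
  fromℤ (+ n)    = n · 1#
  fromℤ -[1+ n ] = - (suc n · 1#)

  fromℤ-neg : ∀ i → fromℤ (ℤ.- i) ≈ - fromℤ i
  fromℤ-neg (+ zero)  = sym -0#≈0#
  fromℤ-neg (+ suc n) = refl
  fromℤ-neg -[1+ n ]  = sym (-‿involutive _)

  cancel : ∀ x y z → x + y - (x + z) ≈ y - z
  cancel x y z = begin
    x + y - (x + z)     ≈⟨ +-congˡ (-‿+-comm x z) ⟨
    x + y + (- x - z)   ≈⟨ +-assoc (x + y) (- x) (- z) ⟨
    x + y - x - z       ≈⟨ +-congʳ (xyx⁻¹≈y x y) ⟩
    y - z               ∎

  fromℤ-⊖ : ∀ m n → fromℤ (m ℤ.⊖ n) ≈ m · 1# - n · 1#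
  fromℤ-⊖ zero    zero    = sym (-‿inverseʳ 0#)
  fromℤ-⊖ zero    (suc n) = sym (+-identityˡ _)
  fromℤ-⊖ (suc m) zero    = sym (trans (+-congˡ -0#≈0#) (+-identityʳ _))
  fromℤ-⊖ (suc m) (suc n) = begin
    fromℤ (suc m ℤ.⊖ suc n)             ≡⟨ ≡.cong fromℤ (ℤ.[1+m]⊖[1+n]≡m⊖n m n) ⟩
    fromℤ (m ℤ.⊖ n)                     ≈⟨ fromℤ-⊖ m n ⟩
    m · 1# - n · 1#                     ≈⟨ cancel 1# _ _ ⟨
    1# + m · 1# - (1# + n · 1#)         ≈⟨ +-cong (1+× m 1#) (-‿cong (1+× n 1#)) ⟨
    suc m · 1# - suc n · 1#             ∎

  fromℤ-+ : ∀ i j → fromℤ (i ℤ.+ j) ≈ fromℤ i + fromℤ j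
  fromℤ-+ (+ m)    (+ n)    = ×-homo-+ 1# m n
  fromℤ-+ (+ m)    -[1+ n ] = fromℤ-⊖ m (suc n)
  fromℤ-+ -[1+ m ] (+ n)    = trans (fromℤ-⊖ n (suc m)) (+-comm _ _)
  fromℤ-+ -[1+ m ] -[1+ n ] = begin
    - (suc (suc (m ℕ.+ n)) · 1#)         ≡⟨ ≡.cong (λ k → - (suc k · 1#)) (≡.sym (ℕ.+-suc m n)) ⟩
    - ((suc m ℕ.+ suc n) · 1#)           ≈⟨ -‿cong (×-homo-+ 1# (suc m) (suc n)) ⟩
    - (suc m · 1# + suc n · 1#)          ≈⟨ -‿+-comm _ _ ⟨
    - (suc m · 1#) - suc n · 1#          ∎

  fromℤ-- : ∀ n → fromℤ (Sign.- ℤ.◃ n) ≈ - (n · 1#)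
  fromℤ-- zero    = sym -0#≈0#
  fromℤ-- (suc n) = refl

  fromℤ-* : ∀ i j → fromℤ (i ℤ.* j) ≈ fromℤ i * fromℤ j
  fromℤ-* (+ m)    (+ n)    = trans (reflexive (≡.cong fromℤ (ℤ.+◃n≡+n (m ℕ.* n)))) (×1-homo-* m n)
  fromℤ-* (+ m)    -[1+ n ] = begin
    fromℤ (Sign.- ℤ.◃ (m ℕ.* suc n))  ≈⟨ fromℤ-- (m ℕ.* suc n) ⟩
    - ((m ℕ.* suc n) · 1#)            ≈⟨ -‿cong (×1-homo-* m (suc n)) ⟩
    - (m · 1# * suc n · 1#)           ≈⟨ -‿distribʳ-* _ _ ⟩
    m · 1# * - (suc n · 1#)           ∎
  fromℤ-* -[1+ m ] (+ n)    = begin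
    fromℤ (Sign.- ℤ.◃ (suc m ℕ.* n))  ≈⟨ fromℤ-- (suc m ℕ.* n) ⟩
    - ((suc m ℕ.* n) · 1#)            ≈⟨ -‿cong (×1-homo-* (suc m) n) ⟩
    - (suc m · 1# * n · 1#)           ≈⟨ -‿distribˡ-* _ _ ⟩
    - (suc m · 1#) * n · 1#           ∎
  fromℤ-* -[1+ m ] -[1+ n ] = begin
    (suc m ℕ.* suc n) · 1#            ≈⟨ ×1-homo-* (suc m) (suc n) ⟩
    suc m · 1# * suc n · 1#           ≈⟨ -‿involutive _ ⟨
    - - (suc m · 1# * suc n · 1#)     ≈⟨ -‿cong (-‿distribˡ-* _ _) ⟩
    - (- (suc m · 1#) * suc n · 1#)   ≈⟨ -‿distribʳ-* _ _ ⟩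
    - (suc m · 1#) * - (suc n · 1#)   ∎

  homomorphism : ℤ.+-*-rawRing -Raw-AlmostCommutative⟶ fromCommutativeRing R
  homomorphism = record
    { ⟦_⟧    = fromℤ
    ; +-homo = fromℤ-+
    ; *-homo = fromℤ-*
    ; -‿homo = fromℤ-neg
    ; 0-homo = refl
    ; 1-homo = refl
    }

  open Algebra.Solver.Ring ℤ.+-*-rawRing (fromCommutativeRing R) homomorphism
    (λ i j → Maybe.map (λ i≡j → reflexive (≡.cong fromℤ i≡j)) (dec⇒maybe (i ℤ.≟ j))) public
    using (solve; _:=_; _:+_; _:*_; _:-_; :-_; con; Polynomial)

-- Segments between points in convex position

module _ {n} (G : Graph n) where

  -- Chords of a convex polygon meet at a point interior to both only when their endpoints
  -- interleave; up to exchanging the edges and the ends of each, the order is then `a`, `c`, `b`,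
  -- `d`.
  NonCrossing : Set
  NonCrossing = ∀ a b c d → a <ᶠ c → c <ᶠ b → b <ᶠ d → Edge G a b → Edge G c d → ⊥

  Covered : Fin n → Set
  Covered i = ∃[ a ] ∃[ b ] a <ᶠ i × i <ᶠ b × Edge G a b

-- The symmetry proof stored in a graph is irrelevant; decidable equality of Booleans allows it to
-- be recomputed.
Edge-sym : ∀ {n} (G : Graph n) {i j} → Edge G i j → Edge G j i
Edge-sym (mkGraph _ symmetric _) {i} {j} e =
  ≡.trans (recompute (_ Bool.≟ _) (symmetric j i)) e

Edge-irrefl : ∀ {n} (G : Graph n) {i} → ¬ Edge G i i
Edge-irrefl (mkGraph _ _ irreflexive) {i} e
  with () ← ≡.trans (≡.sym e) (recompute (_ Bool.≟ _) (irreflexive i))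

Endpoint Inside Outside : ∀ {n} → Fin n → Fin n → Fin n → Set
Endpoint k l m = m ≡ k ⊎ m ≡ l
Inside   k l m = k <ᶠ m × m <ᶠ l
Outside  k l m = m <ᶠ k ⊎ l <ᶠ m

position : ∀ {n} (k l m : Fin n) → Endpoint k l m ⊎ Inside k l m ⊎ Outside k l m
position k l m with Fin.<-cmp k m | Fin.<-cmp m l
... | tri< k<m _ _ | tri< m<l _ _ = inj₂ (inj₁ (k<m , m<l))
... | tri< _ _ _   | tri≈ _ m≡l _ = inj₁ (inj₂ m≡l)
... | tri< _ _ _   | tri> _ _ l<m = inj₂ (inj₂ (inj₂ l<m))
... | tri≈ _ k≡m _ | _            = inj₁ (inj₁ (≡.sym k≡m))
... | tri> _ _ m<k | _            = inj₂ (inj₂ (inj₁ m<k))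

lookup-∷ʳ-inject₁ : ∀ {a} {A : Set a} {n} (xs : Vec A n) (x : A) i →
                    lookup (xs ∷ʳ x) (inject₁ i) ≡ lookup xs i
lookup-∷ʳ-inject₁ (_ ∷ _)  x zero    = ≡.refl
lookup-∷ʳ-inject₁ (_ ∷ xs) x (suc i) = lookup-∷ʳ-inject₁ xs x i

lookup-∷ʳ-fromℕ : ∀ {a} {A : Set a} {n} (xs : Vec A n) (x : A) → lookup (xs ∷ʳ x) (fromℕ n) ≡ x
lookup-∷ʳ-fromℕ []       x = ≡.refl
lookup-∷ʳ-fromℕ (_ ∷ xs) x = lookup-∷ʳ-fromℕ xs x

-- Orientations and segments over an ordered field

module PlaneGeometry {c ℓ₁ ℓ₂} (F : OrderedField c ℓ₁ ℓ₂) where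
  open OrderedField F
  open Geometry F
  open IntegerCoefficients commutativeRing
  open import Algebra.Properties.Ring ring using (-‿involutive; -0#≈0#)
  open import Relation.Binary.Reasoning.Setoid setoid
  module < = IsStrictTotalOrder isStrictTotalOrder

  <-respʳ : ∀ {x y z} → y ≈ z → x < y → x < z
  <-respʳ = <.<-respʳ-≈

  <-respˡ : ∀ {x y z} → x ≈ y → x < z → y < z
  <-respˡ = <.<-respˡ-≈

  >⇒≉ : ∀ {x} → 0# < x → ¬ (x ≈ 0#)
  >⇒≉ 0<x x≈0 = <.irrefl (sym x≈0) 0<x

  +-pos : ∀ {x y} → 0# < x → 0# < y → 0# < x + y
  +-pos {x} {y} 0<x 0<y = <.trans 0<y (<-respˡ (+-identityˡ y) (+-monoˡ-< y 0<x))

  neg-pos : ∀ {x} → x < 0# → 0# < - x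
  neg-pos {x} x<0 = <-respˡ (-‿inverseʳ x) (<-respʳ (+-identityˡ _) (+-monoˡ-< (- x) x<0))

  0<1 : 0# < 1#
  0<1 with <.compare 0# 1#
  ... | tri< 0<1 _ _ = 0<1
  ... | tri≈ _ 0≈1 _ = contradiction 0≈1 0≉1
  ... | tri> _ _ 1<0 = <-respʳ (solve 0 (:- con (+ 1) :* :- con (+ 1) := con (+ 1)) refl)
                         (*-positive (neg-pos 1<0) (neg-pos 1<0))

  0<y-x : ∀ {x y} → x < y → 0# < y - x
  0<y-x {x} x<y = <-respˡ (-‿inverseʳ x) (+-monoˡ-< (- x) x<y)

  0<y-x⇒x<y : ∀ {x y} → 0# < y - x → x < y
  0<y-x⇒x<y {x} {y} 0<y-x = <-respˡ (+-identityˡ x)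
    (<-respʳ (solve 2 (λ x y → y :- x :+ x := y) refl x y) (+-monoˡ-< x 0<y-x))

  positive-inverse : ∀ {x} → 0# < x → ∃[ y ] 0# < y × x * y ≈ 1#
  positive-inverse {x} 0<x with inverse x (>⇒≉ 0<x)
  ... | y , xy≈1 with <.compare 0# y
  ...   | tri< 0<y _ _ = y , 0<y , xy≈1
  ...   | tri≈ _ 0≈y _ = contradiction (trans (trans (sym (zeroʳ x)) (*-congˡ 0≈y)) xy≈1) 0≉1
  -- A negative `y` would make `1# + x * - y` both positive and zero.
  ...   | tri> _ _ y<0 = contradiction (+-pos 0<1 (*-positive 0<x (neg-pos y<0)))
                           (<.irrefl (sym (begin
    1# + x * - y   ≈⟨ +-congʳ xy≈1 ⟨
    x * y + x * - y ≈⟨ solve 2 (λ x y → x :* y :+ x :* :- y := con (+ 0)) refl x y ⟩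
    0#             ∎)))

  product-zero : ∀ {x y} → 0# < y → x * y ≈ 0# → x ≈ 0#
  product-zero {x} {y} 0<y xy≈0 with positive-inverse 0<y
  ... | z , _ , yz≈1 = begin
    x            ≈⟨ *-identityʳ x ⟨
    x * 1#       ≈⟨ *-congˡ yz≈1 ⟨
    x * (y * z)  ≈⟨ *-assoc x y z ⟨
    x * y * z    ≈⟨ *-congʳ xy≈0 ⟩
    0# * z       ≈⟨ zeroˡ z ⟩
    0#           ∎

  combination-positive : ∀ {u v x y} → 0# ≤ u → 0# ≤ v → u + v ≈ 1# → 0# < x → 0# < y →
                         0# < u * x + v * y
  combination-positive {u} {v} {x} {y} (inj₁ 0<u) (inj₁ 0<v) _ 0<x 0<y =
    +-pos (*-positive 0<u 0<x) (*-positive 0<v 0<y)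
  combination-positive {u} {v} {x} {y} (inj₁ 0<u) (inj₂ 0≈v) _ 0<x 0<y =
    <-respʳ (begin
      u * x           ≈⟨ +-identityʳ _ ⟨
      u * x + 0#      ≈⟨ +-congˡ (zeroˡ y) ⟨
      u * x + 0# * y  ≈⟨ +-congˡ (*-congʳ 0≈v) ⟩
      u * x + v * y   ∎) (*-positive 0<u 0<x)
  combination-positive {u} {v} {x} {y} (inj₂ 0≈u) (inj₁ 0<v) _ 0<x 0<y =
    <-respʳ (begin
      v * y           ≈⟨ +-identityˡ _ ⟨
      0# + v * y      ≈⟨ +-congʳ (zeroˡ x) ⟨
      0# * x + v * y  ≈⟨ +-congʳ (*-congʳ 0≈u) ⟩
      u * x + v * y   ∎) (*-positive 0<v 0<y)
  combination-positive (inj₂ 0≈u) (inj₂ 0≈v) u+v≈1 _ _ =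
    contradiction (trans (sym (+-identityˡ 0#)) (trans (+-cong 0≈u 0≈v) u+v≈1)) 0≉1

  0≤1-t : ∀ {t} → t ≤ 1# → 0# ≤ 1# - t
  0≤1-t (inj₁ t<1) = inj₁ (0<y-x t<1)
  0≤1-t (inj₂ t≈1) = inj₂ (sym (trans (+-congˡ (-‿cong t≈1)) (-‿inverseʳ 1#)))

  complement : ∀ t → 1# - t + t ≈ 1#
  complement t = solve 1 (λ t → con (+ 1) :- t :+ t := con (+ 1)) refl t

  -- The polynomial of `CounterClockwise`, so that `CounterClockwise a b d` unfolds to
  -- `0# < orient a b d`.
  orient : Point → Point → Point → Carrier
  orient (x₁ , y₁) (x₂ , y₂) (x₃ , y₃) = (x₂ - x₁) * (y₃ - y₁) - (x₃ - x₁) * (y₂ - y₁)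

  orient-rotate : ∀ a b d → orient a b d ≈ orient b d a
  orient-rotate (x₁ , y₁) (x₂ , y₂) (x₃ , y₃) =
    solve 6 (λ x₁ y₁ x₂ y₂ x₃ y₃ →
      (x₂ :- x₁) :* (y₃ :- y₁) :- (x₃ :- x₁) :* (y₂ :- y₁) :=
      (x₃ :- x₂) :* (y₁ :- y₂) :- (x₁ :- x₂) :* (y₃ :- y₂)) refl x₁ y₁ x₂ y₂ x₃ y₃

  orient-endˡ : ∀ a b → orient a b a ≈ 0#
  orient-endˡ (x₁ , y₁) (x₂ , y₂) =
    solve 4 (λ x₁ y₁ x₂ y₂ →
      (x₂ :- x₁) :* (y₁ :- y₁) :- (x₁ :- x₁) :* (y₂ :- y₁) := con (+ 0)) refl x₁ y₁ x₂ y₂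

  orient-endʳ : ∀ a b → orient a b b ≈ 0#
  orient-endʳ a b = trans (orient-rotate a b b)
    (trans (orient-rotate b b a) (orient-endˡ b a))

  orient-cong : ∀ a b {z w} → z ≈ₚ w → orient a b z ≈ orient a b w
  orient-cong a b (x≈ , y≈) =
    +-cong (*-congˡ (+-congʳ y≈)) (-‿cong (*-congʳ (+-congʳ x≈)))

  -- For fixed `a` and `b` the determinant is affine in the third point. The side of a line on which
  -- a point of a segment lies is thus decided by the two ends of the segment.
  orient-affine : ∀ a b t x y →
                  orient a b (pointAt t x y) ≈ (1# - t) * orient a b x + t * orient a b y
  orient-affine (x₁ , y₁) (x₂ , y₂) t (x₃ , y₃) (x₄ , y₄) =
    solve 9 (λ x₁ y₁ x₂ y₂ t x₃ y₃ x₄ y₄ →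
      (x₂ :- x₁) :* ((con (+ 1) :- t) :* y₃ :+ t :* y₄ :- y₁)
        :- ((con (+ 1) :- t) :* x₃ :+ t :* x₄ :- x₁) :* (y₂ :- y₁) :=
      (con (+ 1) :- t) :* ((x₂ :- x₁) :* (y₃ :- y₁) :- (x₃ :- x₁) :* (y₂ :- y₁))
        :+ t :* ((x₂ :- x₁) :* (y₄ :- y₁) :- (x₄ :- x₁) :* (y₂ :- y₁)))
      refl x₁ y₁ x₂ y₂ t x₃ y₃ x₄ y₄

  private
    area : ∀ {n} (x₁ y₁ x₂ y₂ x₃ y₃ : Polynomial n) → Polynomial n
    area x₁ y₁ x₂ y₂ x₃ y₃ = (x₂ :- x₁) :* (y₃ :- y₁) :- (x₃ :- x₁) :* (y₂ :- y₁)

  -- Either diagonal cuts the quadrilateral into two triangles. This gives the parameters of the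
  -- crossing point on the two diagonals a common denominator.
  quadrilateral-area : ∀ a c b d →
                       orient a c d + orient c b d ≈ orient a c b + orient a b d
  quadrilateral-area (x₁ , y₁) (x₂ , y₂) (x₃ , y₃) (x₄ , y₄) =
    solve 8 (λ x₁ y₁ x₂ y₂ x₃ y₃ x₄ y₄ →
      area x₁ y₁ x₂ y₂ x₄ y₄ :+ area x₂ y₂ x₃ y₃ x₄ y₄ :=
      area x₁ y₁ x₂ y₂ x₃ y₃ :+ area x₁ y₁ x₃ y₃ x₄ y₄)
      refl x₁ y₁ x₂ y₂ x₃ y₃ x₄ y₄

  -- Cramer's rule for the affine relation between four points of the plane: each coefficient is the
  -- area of the triangle on the other three. In convex position all four are positive, and the
  -- relation is the Radon partition into the two diagonals.
  affine-dependence : ∀ a c b d →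
    (orient c b d * proj₁ a + orient a c d * proj₁ b ≈ orient a b d * proj₁ c + orient a c b * proj₁ d) ×
    (orient c b d * proj₂ a + orient a c d * proj₂ b ≈ orient a b d * proj₂ c + orient a c b * proj₂ d)
  affine-dependence (x₁ , y₁) (x₂ , y₂) (x₃ , y₃) (x₄ , y₄) =
    solve 8 (λ x₁ y₁ x₂ y₂ x₃ y₃ x₄ y₄ →
      area x₂ y₂ x₃ y₃ x₄ y₄ :* x₁ :+ area x₁ y₁ x₂ y₂ x₄ y₄ :* x₃ :=
      area x₁ y₁ x₃ y₃ x₄ y₄ :* x₂ :+ area x₁ y₁ x₂ y₂ x₃ y₃ :* x₄)
      refl x₁ y₁ x₂ y₂ x₃ y₃ x₄ y₄ ,
    solve 8 (λ x₁ y₁ x₂ y₂ x₃ y₃ x₄ y₄ →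
      area x₂ y₂ x₃ y₃ x₄ y₄ :* y₁ :+ area x₁ y₁ x₂ y₂ x₄ y₄ :* y₃ :=
      area x₁ y₁ x₃ y₃ x₄ y₄ :* y₂ :+ area x₁ y₁ x₂ y₂ x₃ y₃ :* y₄)
      refl x₁ y₁ x₂ y₂ x₃ y₃ x₄ y₄

  pointAt-cong : ∀ {t s} a b → t ≈ s → pointAt t a b ≈ₚ pointAt s a b
  pointAt-cong a b t≈s = along (proj₁ a) (proj₁ b) , along (proj₂ a) (proj₂ b)
    where
    along : ∀ x y → (1# - _) * x + _ * y ≈ (1# - _) * x + _ * y
    along x y = +-cong (*-congʳ (+-congˡ (-‿cong t≈s))) (*-congʳ t≈s)

  pointAt-0 : ∀ a b → pointAt 0# a b ≈ₚ a
  pointAt-0 (x₁ , y₁) (x₂ , y₂) = along x₁ x₂ , along y₁ y₂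
    where
    along : ∀ x y → (1# - 0#) * x + 0# * y ≈ x
    along = solve 2 (λ x y → (con (+ 1) :- con (+ 0)) :* x :+ con (+ 0) :* y := x) refl

  pointAt-swap : ∀ t a b → pointAt t a b ≈ₚ pointAt (1# - t) b a
  pointAt-swap t (x₁ , y₁) (x₂ , y₂) = along x₁ x₂ , along y₁ y₂
    where
    along : ∀ x y → (1# - t) * x + t * y ≈ (1# - (1# - t)) * y + (1# - t) * x
    along = solve 3 (λ t x y →
      (con (+ 1) :- t) :* x :+ t :* y :=
      (con (+ 1) :- (con (+ 1) :- t)) :* y :+ (con (+ 1) :- t) :* x) refl t

  ≈ₚ-trans : ∀ {z w v} → z ≈ₚ w → w ≈ₚ v → z ≈ₚ v
  ≈ₚ-trans (x≈ , y≈) (x≈′ , y≈′) = trans x≈ x≈′ , trans y≈ y≈′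

  1-[1-t]≈t : ∀ t → 1# - (1# - t) ≈ t
  1-[1-t]≈t = solve 1 (λ t → con (+ 1) :- (con (+ 1) :- t) := t) refl

  OnSegment-swap : ∀ a b {z} → OnSegment a b z → OnSegment b a z
  OnSegment-swap a b (t , 0≤t , t≤1 , z≈) =
    1# - t , 0≤1-t t≤1 , 1-t≤1 0≤t , ≈ₚ-trans z≈ (pointAt-swap t a b)
    where
    1-t≤1 : 0# ≤ t → 1# - t ≤ 1#
    1-t≤1 (inj₁ 0<t) = inj₁ (0<y-x⇒x<y (<-respʳ (sym (1-[1-t]≈t t)) 0<t))
    1-t≤1 (inj₂ 0≈t) = inj₂ (trans (+-congˡ (trans (-‿cong (sym 0≈t)) -0#≈0#)) (+-identityʳ 1#))

  interior⇒onSegment : ∀ a b {z} → InSegmentInterior a b z → OnSegment a b z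
  interior⇒onSegment a b (t , 0<t , t<1 , z≈) = t , inj₁ 0<t , inj₁ t<1 , z≈

  interior-swap : ∀ a b {z} → InSegmentInterior a b z → InSegmentInterior b a z
  interior-swap a b (t , 0<t , t<1 , z≈) =
    1# - t , 0<y-x t<1 , 0<y-x⇒x<y (<-respʳ (sym (1-[1-t]≈t t)) 0<t) , ≈ₚ-trans z≈ (pointAt-swap t a b)

  onLine : ∀ a b {z} → OnSegment a b z → orient a b z ≈ 0#
  onLine a b {z} (t , _ , _ , z≈) = begin
    orient a b z                                     ≈⟨ orient-cong a b z≈ ⟩
    orient a b (pointAt t a b)                       ≈⟨ orient-affine a b t a b ⟩
    (1# - t) * orient a b a + t * orient a b b       ≈⟨ +-cong (*-congˡ (orient-endˡ a b))
                                                               (*-congˡ (orient-endʳ a b)) ⟩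
    (1# - t) * 0# + t * 0#                           ≈⟨ +-cong (zeroʳ _) (zeroʳ _) ⟩
    0# + 0#                                          ≈⟨ +-identityˡ 0# ⟩
    0#                                               ∎

  same-side⇒off-line : ∀ a b x y {z} → OnSegment x y z → 0# < orient a b x → 0# < orient a b y →
                       0# < orient a b z
  same-side⇒off-line a b x y (t , 0≤t , t≤1 , z≈) 0<x 0<y =
    <-respʳ (sym (trans (orient-cong a b z≈) (orient-affine a b t x y)))
      (combination-positive (0≤1-t t≤1) 0≤t (complement t) 0<x 0<y)

  interior-side : ∀ a b x y {z} → InSegmentInterior x y z → 0# ≤ orient a b x → 0# < orient a b y →
                  0# < orient a b z
  interior-side a b x y (t , 0<t , t<1 , z≈) 0≤x 0<y =
    <-respʳ (sym (trans (orient-cong a b z≈) (orient-affine a b t x y))) (step 0≤x)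
    where
    step : 0# ≤ orient a b x → 0# < (1# - t) * orient a b x + t * orient a b y
    step (inj₁ 0<x) = +-pos (*-positive (0<y-x t<1) 0<x) (*-positive 0<t 0<y)
    step (inj₂ 0≈x) = <-respʳ (begin
      t * orient a b y                              ≈⟨ +-identityˡ _ ⟨
      0# + t * orient a b y                         ≈⟨ +-congʳ (zeroʳ (1# - t)) ⟨
      (1# - t) * 0# + t * orient a b y              ≈⟨ +-congʳ (*-congˡ 0≈x) ⟩
      (1# - t) * orient a b x + t * orient a b y    ∎) (*-positive 0<t 0<y)

  -- Since `x` is on the line, the determinant at parameter `t` is `t * orient a b y`, which
  -- vanishes only for `t ≈ 0#`.
  meets-at-start : ∀ a b x y {z} → OnSegment x y z → orient a b z ≈ 0# →
                   orient a b x ≈ 0# → 0# < orient a b y → z ≈ₚ x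
  meets-at-start a b x y {z} (t , _ , _ , z≈) z≈0 x≈0 0<y =
    ≈ₚ-trans z≈ (≈ₚ-trans (pointAt-cong x y t≈0) (pointAt-0 x y))
    where
    t≈0 : t ≈ 0#
    t≈0 = product-zero 0<y (begin
      t * orient a b y                            ≈⟨ +-identityˡ _ ⟨
      0# + t * orient a b y                       ≈⟨ +-congʳ (zeroʳ (1# - t)) ⟨
      (1# - t) * 0# + t * orient a b y            ≈⟨ +-congʳ (*-congˡ x≈0) ⟨
      (1# - t) * orient a b x + t * orient a b y  ≈⟨ orient-affine a b t x y ⟨
      orient a b (pointAt t x y)                  ≈⟨ orient-cong a b z≈ ⟨
      orient a b z                                ≈⟨ z≈0 ⟩
      0#                                          ∎)

  diagonals-cross : ∀ a c b d → CounterClockwise a c b → CounterClockwise a b d →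
                    CounterClockwise a c d → CounterClockwise c b d →
                    ∃[ z ] InSegmentInterior a b z × InSegmentInterior c d z
  diagonals-cross a c b d 0<γ 0<δ 0<α 0<β = 
    -- Both sides of the affine dependence are divided by the common total `α + β`, which equals
    -- `γ + δ`; `r` is its inverse.
    pointAt (α * r) a b ,
    (α * r , *-positive 0<α 0<r , fraction<1 0<β [α+β]r≈1 , refl , refl) ,
    (γ * r , *-positive 0<γ 0<r , fraction<1 0<δ [γ+δ]r≈1 ,
      meet (proj₁ (affine-dependence a c b d)) , meet (proj₂ (affine-dependence a c b d)))
    where
    α β γ δ r : Carrier
    α = orient a c d
    β = orient c b d
    γ = orient a c b
    δ = orient a b d
    r,r : ∃[ y ] 0# < y × (α + β) * y ≈ 1#
    r,r = positive-inverse (+-pos 0<α 0<β)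
    r = proj₁ r,r
    0<r : 0# < r
    0<r = proj₁ (proj₂ r,r)
    [α+β]r≈1 : (α + β) * r ≈ 1#
    [α+β]r≈1 = proj₂ (proj₂ r,r)
    [γ+δ]r≈1 : (γ + δ) * r ≈ 1#
    [γ+δ]r≈1 = trans (*-congʳ (sym (quadrilateral-area a c b d))) [α+β]r≈1

    1-xr≈yr : ∀ {x y} → (x + y) * r ≈ 1# → 1# - x * r ≈ y * r
    1-xr≈yr {x} {y} eq = trans (+-congʳ (sym eq))
      (solve 3 (λ x y r → (x :+ y) :* r :- x :* r := y :* r) refl x y r)

    fraction<1 : ∀ {x y} → 0# < y → (x + y) * r ≈ 1# → x * r < 1#
    fraction<1 0<y eq = 0<y-x⇒x<y (<-respʳ (sym (1-xr≈yr eq)) (*-positive 0<y 0<r))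

    meet : ∀ {x₁ x₂ x₃ x₄} → β * x₁ + α * x₂ ≈ δ * x₃ + γ * x₄ →
           (1# - α * r) * x₁ + α * r * x₂ ≈ (1# - γ * r) * x₃ + γ * r * x₄
    meet {x₁} {x₂} {x₃} {x₄} eq = begin
      (1# - α * r) * x₁ + α * r * x₂  ≈⟨ +-congʳ (*-congʳ (1-xr≈yr [α+β]r≈1)) ⟩
      β * r * x₁ + α * r * x₂         ≈⟨ factor β α x₁ x₂ ⟩
      r * (β * x₁ + α * x₂)           ≈⟨ *-congˡ eq ⟩
      r * (δ * x₃ + γ * x₄)           ≈⟨ factor δ γ x₃ x₄ ⟨
      δ * r * x₃ + γ * r * x₄         ≈⟨ +-congʳ (*-congʳ (1-xr≈yr [γ+δ]r≈1)) ⟨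
      (1# - γ * r) * x₃ + γ * r * x₄  ∎
      where
      factor : ∀ u v x y → u * r * x + v * r * y ≈ r * (u * x + v * y)
      factor u v x y = solve 5 (λ r u v x y →
        u :* r :* x :+ v :* r :* y := r :* (u :* x :+ v :* y)) refl r u v x y

  -- Planarity and visibility for points in convex position

  module ConvexGeometry {n} (p : Vec Point n) (q : Point)
                        (convex : ConvexPosition (p ∷ʳ q)) (G : Graph n) where

    P : Fin n → Point
    P = lookup p

    private
      transport : ∀ {a a′ b b′ d d′} → a ≡ a′ → b ≡ b′ → d ≡ d′ →
                  CounterClockwise a b d → CounterClockwise a′ b′ d′
      transport ≡.refl ≡.refl ≡.refl ccw = ccw

      inject₁-mono : ∀ {i j : Fin n} → i <ᶠ j → inject₁ i <ᶠ inject₁ j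
      inject₁-mono {i} {j} = ≡.subst₂ ℕ._<_ (≡.sym (Fin.toℕ-inject₁ i)) (≡.sym (Fin.toℕ-inject₁ j))

      inject₁<fromℕ : ∀ (i : Fin n) → inject₁ i <ᶠ fromℕ n
      inject₁<fromℕ i =
        ≡.subst₂ ℕ._<_ (≡.sym (Fin.toℕ-inject₁ i)) (≡.sym (Fin.toℕ-fromℕ n)) (Fin.toℕ<n i)

    ccw : ∀ {i j k} → i <ᶠ j → j <ᶠ k → CounterClockwise (P i) (P j) (P k)
    ccw i<j j<k = transport (lookup-∷ʳ-inject₁ p q _) (lookup-∷ʳ-inject₁ p q _) (lookup-∷ʳ-inject₁ p q _)
      (convex (inject₁-mono i<j) (inject₁-mono j<k))

    ccw-q : ∀ {i j} → i <ᶠ j → CounterClockwise (P i) (P j) q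
    ccw-q i<j = transport (lookup-∷ʳ-inject₁ p q _) (lookup-∷ʳ-inject₁ p q _) (lookup-∷ʳ-fromℕ p q)
      (convex (inject₁-mono i<j) (inject₁<fromℕ _))

    plane⇒noncrossing : Plane p G → NonCrossing G
    plane⇒noncrossing plane a b c d a<c c<b b<d ab cd =
      crossing (diagonals-cross (P a) (P c) (P b) (P d) (ccw a<c c<b) (ccw (Fin.<-trans a<c c<b) b<d)
                 (ccw a<c (Fin.<-trans c<b b<d)) (ccw c<b b<d))
      where
      disjoint : ∀ {m} → m ≡ a ⊎ m ≡ b → m ≡ c ⊎ m ≡ d → ⊥
      disjoint (inj₁ ≡.refl) (inj₁ a≡c) = Fin.<⇒≢ a<c a≡c
      disjoint (inj₁ ≡.refl) (inj₂ a≡d) = Fin.<⇒≢ (Fin.<-trans a<c (Fin.<-trans c<b b<d)) a≡d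
      disjoint (inj₂ ≡.refl) (inj₁ b≡c) = Fin.<⇒≢ c<b (≡.sym b≡c)
      disjoint (inj₂ ≡.refl) (inj₂ b≡d) = Fin.<⇒≢ b<d b≡d

      distinct : ¬ SameEdge p G a b c d
      distinct (inj₁ (a≡c , _)) = disjoint (inj₁ ≡.refl) (inj₁ a≡c)
      distinct (inj₂ (a≡d , _)) = disjoint (inj₁ ≡.refl) (inj₂ a≡d)

      crossing : ¬ (∃[ z ] InSegmentInterior (P a) (P b) z × InSegmentInterior (P c) (P d) z)
      crossing (z , z∈ab , z∈cd) =
        let m , m∈ab , m∈cd , _ = plane a b c d ab cd distinct z
              (interior⇒onSegment (P a) (P b) z∈ab) (interior⇒onSegment (P c) (P d) z∈cd)
        in disjoint m∈ab m∈cd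

    outside-left : ∀ {k l m} → k <ᶠ l → Outside k l m → 0# < orient (P k) (P l) (P m)
    outside-left {k} {l} {m} k<l (inj₁ m<k) = <-respʳ (orient-rotate (P m) (P k) (P l)) (ccw m<k k<l)
    outside-left k<l (inj₂ l<m) = ccw k<l l<m

    -- The line is reversed so that both of its sides are expressed by positive determinants, and
    -- the same lemmas about segments serve for both.
    inside-right : ∀ {k l m} → Inside k l m → 0# < orient (P l) (P k) (P m)
    inside-right {k} {l} {m} (k<m , m<l) =
      <-respʳ (trans (orient-rotate (P k) (P m) (P l)) (orient-rotate (P m) (P l) (P k))) (ccw k<m m<l)

    endpoint-on : ∀ {k l m} → Endpoint k l m → orient (P k) (P l) (P m) ≈ 0#
    endpoint-on {k} {l} (inj₁ ≡.refl) = orient-endˡ (P k) (P l)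
    endpoint-on {k} {l} (inj₂ ≡.refl) = orient-endʳ (P k) (P l)

    -- Only the line through `P k` and `P l` matters. If `i` and `j` lie strictly on one side, the
    -- segment misses the line; on opposite sides, the edges interleave; with exactly one of them on
    -- the line, that vertex is the only meeting point; with both, the edge is a loop or the same
    -- edge.
    noncrossing⇒plane-ordered : NonCrossing G → ∀ {i j k l} → k <ᶠ l → Edge G i j → Edge G k l →
      ¬ SameEdge p G i j k l → ∀ z → OnSegment (P i) (P j) z → OnSegment (P k) (P l) z →
      CommonEndpoint p G i j k l z
    noncrossing⇒plane-ordered nc {i} {j} {k} {l} k<l ij kl ¬same z z∈ij z∈kl =
      meet (position k l i) (position k l j)
      where
      z∈lk : OnSegment (P l) (P k) z
      z∈lk = OnSegment-swap (P k) (P l) z∈kl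

      separated : ∀ {i j} → Edge G i j → Inside k l i → ¬ Outside k l j
      separated ij (k<i , i<l) (inj₁ j<k) = nc _ _ _ _ j<k k<i i<l (Edge-sym G ij) kl
      separated ij (k<i , i<l) (inj₂ l<j) = nc _ _ _ _ k<i i<l l<j kl ij

      at-endpoint : ∀ i j → OnSegment (P i) (P j) z → Endpoint k l i → Inside k l j ⊎ Outside k l j →
                    z ≈ₚ P i
      at-endpoint i j z∈ij i∈ (inj₁ j-in)  =
        meets-at-start (P l) (P k) (P i) (P j) {z} z∈ij
          (onLine (P l) (P k) {z} z∈lk) (endpoint-on {l} {k} {i} (swap i∈))
          (inside-right {k} {l} {j} j-in)
      at-endpoint i j z∈ij i∈ (inj₂ j-out) =
        meets-at-start (P k) (P l) (P i) (P j) {z} z∈ij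
          (onLine (P k) (P l) {z} z∈kl) (endpoint-on {k} {l} {i} i∈)
          (outside-left {k} {l} {j} k<l j-out)

      loop : ∀ {m} → i ≡ m → j ≡ m → ⊥
      loop ≡.refl ≡.refl = Edge-irrefl G ij

      both-inside : Inside k l i → Inside k l j → ⊥
      both-inside i-in j-in =
        >⇒≉ (same-side⇒off-line (P l) (P k) (P i) (P j) {z} z∈ij (inside-right i-in) (inside-right j-in))
            (onLine (P l) (P k) {z} z∈lk)

      both-outside : Outside k l i → Outside k l j → ⊥
      both-outside i-out j-out =
        >⇒≉ (same-side⇒off-line (P k) (P l) (P i) (P j) {z} z∈ij
              (outside-left k<l i-out) (outside-left k<l j-out))
            (onLine (P k) (P l) {z} z∈kl)

      meet : Endpoint k l i ⊎ Inside k l i ⊎ Outside k l i →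
             Endpoint k l j ⊎ Inside k l j ⊎ Outside k l j → CommonEndpoint p G i j k l z
      meet (inj₁ (inj₁ i≡k)) (inj₁ (inj₁ j≡k)) = ⊥-elim (loop i≡k j≡k)
      meet (inj₁ (inj₁ i≡k)) (inj₁ (inj₂ j≡l)) = ⊥-elim (¬same (inj₁ (i≡k , j≡l)))
      meet (inj₁ (inj₂ i≡l)) (inj₁ (inj₁ j≡k)) = ⊥-elim (¬same (inj₂ (i≡l , j≡k)))
      meet (inj₁ (inj₂ i≡l)) (inj₁ (inj₂ j≡l)) = ⊥-elim (loop i≡l j≡l)
      meet (inj₁ i∈) (inj₂ j∉) = i , inj₁ ≡.refl , i∈ , at-endpoint i j z∈ij i∈ j∉
      meet (inj₂ i∉) (inj₁ j∈) =
        j , inj₂ ≡.refl , j∈ , at-endpoint j i (OnSegment-swap (P i) (P j) {z} z∈ij) j∈ i∉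
      meet (inj₂ (inj₁ i-in)) (inj₂ (inj₂ j-out)) = ⊥-elim (separated ij i-in j-out)
      meet (inj₂ (inj₂ i-out)) (inj₂ (inj₁ j-in)) = ⊥-elim (separated (Edge-sym G ij) j-in i-out)
      meet (inj₂ (inj₁ i-in)) (inj₂ (inj₁ j-in)) = ⊥-elim (both-inside i-in j-in)
      meet (inj₂ (inj₂ i-out)) (inj₂ (inj₂ j-out)) = ⊥-elim (both-outside i-out j-out)

    noncrossing⇒plane : NonCrossing G → Plane p G
    noncrossing⇒plane nc i j k l ij kl ¬same z z∈ij z∈kl with Fin.<-cmp k l
    ... | tri< k<l _ _ = noncrossing⇒plane-ordered nc k<l ij kl ¬same z z∈ij z∈kl
    ... | tri≈ _ ≡.refl _ = contradiction kl (Edge-irrefl G)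
    ... | tri> _ _ l<k
      with noncrossing⇒plane-ordered nc l<k ij (Edge-sym G kl) 
             (¬same ∘ swap) z z∈ij (OnSegment-swap (P k) (P l) z∈kl)
    ...   | m , m∈ij , m∈lk , z≈ = m , m∈ij , swap m∈lk , z≈

    covered⇒blocked : ∀ {i} → Covered G i → ¬ Visible p G q (P i)
    covered⇒blocked {i} (a , b , a<i , i<b , ab) visible =
      -- The covering edge and the line of sight are the diagonals of the convex quadrilateral
      -- `P a`, `P i`, `P b`, `q`.
      let z , z∈ab , z∈iq = diagonals-cross (P a) (P i) (P b) q
                              (ccw a<i i<b) (ccw-q (Fin.<-trans a<i i<b)) (ccw-q a<i) (ccw-q i<b)
      in visible a b ab (z , OnSegment-swap (P i) q (interior⇒onSegment (P i) q z∈iq) , z∈ab)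

    after : ∀ {i m} → i Fin.≤ m → 0# ≤ orient q (P i) (P m)
    after {i} {m} i≤m with Fin.<-cmp i m
    ... | tri< i<m _ _    = inj₁ (<-respʳ (sym (orient-rotate q (P i) (P m))) (ccw-q i<m))
    ... | tri≈ _ ≡.refl _ = inj₂ (sym (orient-endʳ q (P i)))
    ... | tri> _ _ m<i    = contradiction i≤m (ℕ.<⇒≱ m<i)

    before : ∀ {i m} → m Fin.≤ i → 0# ≤ orient (P i) q (P m)
    before {i} {m} m≤i with Fin.<-cmp m i
    ... | tri< m<i _ _    = inj₁ (<-respʳ (orient-rotate (P m) (P i) q) (ccw-q m<i))
    ... | tri≈ _ ≡.refl _ = inj₂ (sym (orient-endˡ (P i) q))
    ... | tri> _ _ i<m    = contradiction m≤i (ℕ.<⇒≱ i<m)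

    -- The line through `q` and `P i` separates the vertices before `i` from those after it. An edge
    -- not covering `i` stays weakly on one side and has at most one end on the line, so its
    -- interior lies strictly on that side.
    uncovered⇒unblocked : ∀ {i a b} → a <ᶠ b → ¬ (a <ᶠ i × i <ᶠ b) →
      ∀ {z} → OnSegment q (P i) z → ¬ InSegmentInterior (P a) (P b) z
    uncovered⇒unblocked {i} {a} {b} a<b i∉ab z∈qi z∈ab with Fin._<?_ a i
    ... | no a≮i = >⇒≉ (interior-side q (P i) (P a) (P b) z∈ab (after i≤a)
        (<-respʳ (sym (orient-rotate q (P i) (P b))) (ccw-q i<b))) (onLine q (P i) z∈qi)
      where
      i≤a = ℕ.≮⇒≥ a≮i
      i<b = ℕ.≤-<-trans i≤a a<b
    ... | yes a<i = >⇒≉ (interior-side (P i) q (P b) (P a) (interior-swap (P a) (P b) z∈ab) (before b≤i)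
        (<-respʳ (orient-rotate (P a) (P i) q) (ccw-q a<i)))
        (onLine (P i) q (OnSegment-swap q (P i) z∈qi))
      where
      b≤i = ℕ.≮⇒≥ (λ i<b → i∉ab (a<i , i<b))

    visible⇔uncovered : ∀ {i} → Visible p G q (P i) ⇔ (¬ Covered G i)
    visible⇔uncovered {i} = mk⇔ (λ visible covered → covered⇒blocked covered visible) to
      where
      to : ¬ Covered G i → Visible p G q (P i)
      to uncovered a b ab (z , z∈qi , z∈ab) with Fin.<-cmp a b
      ... | tri< a<b _ _ = uncovered⇒unblocked a<b
              (λ (a<i , i<b) → uncovered (a , b , a<i , i<b , ab)) z∈qi z∈ab
      ... | tri≈ _ ≡.refl _ = Edge-irrefl G ab
      ... | tri> _ _ b<a = uncovered⇒unblocked b<a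
              (λ (b<i , i<a) → uncovered (b , a , b<i , i<a , Edge-sym G ab))
              z∈qi (interior-swap (P a) (P b) z∈ab)

-- Generating noncrossing graphs vertex by vertex

open import Data.Nat.Base using (_+_; _*_; _∸_; _^_; _≤_; _<_; _≡ᵇ_)
open ≡ using (refl; sym; trans; cong; cong₂; subst)
open ≡-Reasoning
open Equivalence using (to; from)

≡-graph : ∀ {n} {G H : Graph n} → Graph.adjacency G ≡ Graph.adjacency H → G ≡ H
≡-graph refl = refl

firstRow : ∀ {n} → Graph (suc n) → Vec Bool n
firstRow (mkGraph A _ _) = tail (head A)

lookup-map-tail : ∀ {n m} (rows : Vec (Vec Bool (suc n)) m) i j →
                  lookup (lookup (Vec.map tail rows) i) j ≡ lookup (lookup rows i) (suc j)
lookup-map-tail ((_ ∷ _) ∷ _)  zero    j = refl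
lookup-map-tail (_ ∷ rows) (suc i) j = lookup-map-tail rows i j

dropFirst : ∀ {n} → Graph (suc n) → Graph n
dropFirst (mkGraph (_ ∷ rows) symmetric irreflexive) = mkGraph (Vec.map tail rows)
  (λ i j → trans (lookup-map-tail rows i j)
             (trans (symmetric (suc i) (suc j)) (sym (lookup-map-tail rows j i))))
  (λ i → trans (lookup-map-tail rows i i) (irreflexive (suc i)))

lookup-zipWith-∷ : ∀ {n m} (r : Vec Bool m) (rows : Vec (Vec Bool n) m) i →
                   lookup (zipWith Vec._∷_ r rows) i ≡ lookup r i Vec.∷ lookup rows i
lookup-zipWith-∷ r rows i = Vec.lookup-zipWith Vec._∷_ i r rows

addFirst : ∀ {n} → Vec Bool n → Graph n → Graph (suc n)
addFirst {n} r (mkGraph A symmetric irreflexive) = 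
  mkGraph A′ (addFirst-symmetric symmetric) (addFirst-irreflexive irreflexive)
  where
  A′ : Vec (Vec Bool (suc n)) (suc n)
  A′ = (false ∷ r) ∷ zipWith _∷_ r A

  entry : ∀ i j → lookup (lookup A′ (suc i)) j ≡ lookup (lookup r i ∷ lookup A i) j
  entry i j = cong (λ row → lookup row j) (lookup-zipWith-∷ r A i)

  addFirst-symmetric : (∀ i j → lookup (lookup A i) j ≡ lookup (lookup A j) i) →
                       ∀ i j → lookup (lookup A′ i) j ≡ lookup (lookup A′ j) i
  addFirst-symmetric symmetric zero    zero    = refl
  addFirst-symmetric symmetric zero    (suc j) = sym (entry j zero)
  addFirst-symmetric symmetric (suc i) zero    = entry i zero
  addFirst-symmetric symmetric (suc i) (suc j) =
    trans (entry i (suc j)) (trans (symmetric i j) (sym (entry j (suc i))))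

  addFirst-irreflexive : (∀ i → lookup (lookup A i) i ≡ false) → ∀ i → lookup (lookup A′ i) i ≡ false
  addFirst-irreflexive irreflexive zero    = refl
  addFirst-irreflexive irreflexive (suc i) = trans (entry i (suc i)) (irreflexive i)

firstRow-addFirst : ∀ {n} r (G : Graph n) → firstRow (addFirst r G) ≡ r
firstRow-addFirst r (mkGraph _ _ _) = refl

map-tail-zipWith : ∀ {n m} (r : Vec Bool m) (rows : Vec (Vec Bool n) m) →
                   Vec.map tail (zipWith _∷_ r rows) ≡ rows
map-tail-zipWith []      []           = refl
map-tail-zipWith (_ ∷ r) (row ∷ rows) = cong (row ∷_) (map-tail-zipWith r rows)

dropFirst-addFirst : ∀ {n} r (G : Graph n) → dropFirst (addFirst r G) ≡ G
dropFirst-addFirst r (mkGraph A _ _) = ≡-graph (map-tail-zipWith r A)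

addFirst-firstRow-dropFirst : ∀ {n} (G : Graph (suc n)) → addFirst (firstRow G) (dropFirst G) ≡ G
addFirst-firstRow-dropFirst (mkGraph ((b ∷ r) ∷ rows) symmetric irreflexive) =
  ≡-graph (cong₂ (λ b rows → (b ∷ r) ∷ rows)
    (sym (recompute (_ Bool.≟ _) (irreflexive zero)))
    (columns r rows (λ i → recompute (_ Bool.≟ _) (symmetric zero (suc i)))))
  where
  columns : ∀ {n m} (r : Vec Bool m) (rows : Vec (Vec Bool (suc n)) m) →
            (∀ i → lookup r i ≡ lookup (lookup rows i) zero) →
            zipWith _∷_ r (Vec.map tail rows) ≡ rows
  columns []      []                 eq = refl
  columns (_ ∷ r) ((_ ∷ row) ∷ rows) eq =
    cong₂ (λ b → (b ∷ row) ∷_) (eq zero) (columns r rows (eq ∘ suc))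

Edge-first : ∀ {n} (G : Graph (suc n)) {j} → Edge G zero (suc j) ≡ (lookup (firstRow G) j ≡ true)
Edge-first (mkGraph ((_ ∷ _) ∷ _) _ _) = refl

Edge-dropFirst : ∀ {n} (G : Graph (suc n)) {i j} → Edge G (suc i) (suc j) ≡ Edge (dropFirst G) i j
Edge-dropFirst (mkGraph (_ ∷ rows) _ _) {i} {j} = cong (_≡ true) (sym (lookup-map-tail rows i j))

-- Uncovered vertices as bit vectors

nonempty : ∀ {n} → Vec Bool n → Bool
nonempty []      = false
nonempty (b ∷ r) = b ∨ nonempty r

-- The emptiness test concerns strictly later entries only, so the last new neighbour itself stays
-- uncovered.
remaining : ∀ {n} → Vec Bool n → Vec Bool n → Vec Bool n
remaining []      []      = []
remaining (_ ∷ r) (b ∷ u) = (b ∧ not (nonempty r)) ∷ remaining r u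

uncovered : ∀ {n} → Graph n → Vec Bool n
uncovered {zero}  _ = []
uncovered {suc n} G = true ∷ remaining (firstRow G) (uncovered (dropFirst G))

nonempty-intro : ∀ {n} (r : Vec Bool n) i → lookup r i ≡ true → nonempty r ≡ true
nonempty-intro (true  ∷ r) zero    eq = refl
nonempty-intro (true  ∷ r) (suc i) eq = refl
nonempty-intro (false ∷ r) (suc i) eq = nonempty-intro r i eq

nonempty-elim : ∀ {n} (r : Vec Bool n) → nonempty r ≡ true → ∃[ i ] lookup r i ≡ true
nonempty-elim (true  ∷ r) eq = zero , refl
nonempty-elim (false ∷ r) eq = let i , rᵢ = nonempty-elim r eq in suc i , rᵢ

remaining⇔ : ∀ {n} (r u : Vec Bool n) i →
             lookup (remaining r u) i ≡ true ⇔
             (lookup u i ≡ true × ∀ {j} → i <ᶠ j → lookup r j ≢ true)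
remaining⇔ (b ∷ r) (false ∷ u) zero = mk⇔ (λ ()) (λ ())
remaining⇔ (b ∷ r) (true ∷ u)  zero with nonempty r in eq
... | true  = mk⇔ (λ ()) (λ (_ , later) →
                let i , rᵢ = nonempty-elim r eq in ⊥-elim (later {suc i} (s≤s z≤n) rᵢ))
... | false = mk⇔ (λ _ → refl , λ { {suc j} _ rⱼ →
                contradiction (trans (sym eq) (nonempty-intro r j rⱼ)) λ () })
                  (λ _ → refl)
remaining⇔ (b ∷ r) (_ ∷ u) (suc i) = mk⇔
  (λ eq → let uᵢ , later = to (remaining⇔ r u i) eq in uᵢ , λ { {suc j} (s≤s i<j) → later i<j })
  (λ (uᵢ , later) → from (remaining⇔ r u i) (uᵢ , λ i<j → later (s≤s i<j)))

cast : ∀ {a} {A B : Set a} → A ≡ B → A → B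
cast refl x = x

uncovered⇔ : ∀ {n} (G : Graph n) i → lookup (uncovered G) i ≡ true ⇔ (¬ Covered G i)
uncovered⇔ {suc n} G zero    = mk⇔ (λ _ ()) (λ _ → refl)
uncovered⇔ {suc n} G (suc i) = mk⇔ forward backward
  where
  open Equivalence (remaining⇔ (firstRow G) (uncovered (dropFirst G)) i)
    using () renaming (to to split; from to join)
  open Equivalence (uncovered⇔ (dropFirst G) i)
    using () renaming (to to sound; from to complete)

  forward : lookup (uncovered G) (suc i) ≡ true → ¬ Covered G (suc i)
  forward eq (zero  , suc b , _ , s≤s i<b , e) = proj₂ (split eq) i<b (cast (Edge-first G) e)
  forward eq (suc a , suc b , s≤s a<i , s≤s i<b , e) =
    sound (proj₁ (split eq)) (a , b , a<i , i<b , cast (Edge-dropFirst G) e)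

  backward : ¬ Covered G (suc i) → lookup (uncovered G) (suc i) ≡ true
  backward ¬covered = join
    ( complete (λ (a , b , a<i , i<b , e) →
        ¬covered (suc a , suc b , s≤s a<i , s≤s i<b , cast (sym (Edge-dropFirst G)) e))
    , λ {j} i<j rⱼ → ¬covered (zero , suc j , s≤s z≤n , s≤s i<j , cast (sym (Edge-first G)) rⱼ))

infix 4 _⊑_
_⊑_ : ∀ {n} → Vec Bool n → Vec Bool n → Set
r ⊑ u = ∀ j → lookup r j ≡ true → lookup u j ≡ true

-- In an interleaved pair only the edge with the smallest endpoint can contain the new vertex. An
-- edge from there to `b` is crossed exactly when some old edge covers `b`.
noncrossing⇔ : ∀ {n} (G : Graph (suc n)) →
               NonCrossing G ⇔ (NonCrossing (dropFirst G) × firstRow G ⊑ uncovered (dropFirst G))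
noncrossing⇔ G = mk⇔ forward backward
  where
  lift : ∀ {i j} → Edge (dropFirst G) i j → Edge G (suc i) (suc j)
  lift = cast (sym (Edge-dropFirst G))

  lower : ∀ {i j} → Edge G (suc i) (suc j) → Edge (dropFirst G) i j
  lower = cast (Edge-dropFirst G)

  forward : NonCrossing G → NonCrossing (dropFirst G) × firstRow G ⊑ uncovered (dropFirst G)
  forward nc =
    (λ a b c d a<c c<b b<d ab cd → nc _ _ _ _ (s≤s a<c) (s≤s c<b) (s≤s b<d) (lift ab) (lift cd)) ,
    (λ j rⱼ → from (uncovered⇔ (dropFirst G) j) λ (a , b , a<j , j<b , ab) →
      nc _ _ _ _ (s≤s z≤n) (s≤s a<j) (s≤s j<b) (cast (sym (Edge-first G)) rⱼ) (lift ab))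

  backward : NonCrossing (dropFirst G) × firstRow G ⊑ uncovered (dropFirst G) → NonCrossing G
  backward (nc , row) zero (suc b) (suc c) (suc d) a<c (s≤s c<b) (s≤s b<d) ab cd =
    to (uncovered⇔ (dropFirst G) b) (row b (cast (Edge-first G) ab)) (c , d , c<b , b<d , lower cd)
  backward (nc , row) (suc a) (suc b) (suc c) (suc d) (s≤s a<c) (s≤s c<b) (s≤s b<d) ab cd =
    nc a b c d a<c c<b b<d (lower ab) (lower cd)

-- Enumeration of noncrossing graphs without repetition

subsets : ∀ {n} → Vec Bool n → List (Vec Bool n)
subsets []          = [ [] ]
subsets (false ∷ u) = map (false Vec.∷_) (subsets u)
subsets (true ∷ u)  = map (false Vec.∷_) (subsets u) ++ map (true Vec.∷_) (subsets u)

∈-subsets⁺ : ∀ {n} (r u : Vec Bool n) → r ⊑ u → r ∈ subsets u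
∈-subsets⁺ []          []          r⊑u = here refl
∈-subsets⁺ (true ∷ r)  (false ∷ u) r⊑u with () ← r⊑u zero refl
∈-subsets⁺ (false ∷ r) (false ∷ u) r⊑u = ∈-map⁺ (false Vec.∷_) (∈-subsets⁺ r u (r⊑u ∘ suc))
∈-subsets⁺ (false ∷ r) (true ∷ u)  r⊑u = ∈-++⁺ˡ (∈-map⁺ (false Vec.∷_) (∈-subsets⁺ r u (r⊑u ∘ suc)))
∈-subsets⁺ (true ∷ r)  (true ∷ u)  r⊑u =
  ∈-++⁺ʳ (map (false Vec.∷_) (subsets u)) (∈-map⁺ (true Vec.∷_) (∈-subsets⁺ r u (r⊑u ∘ suc)))

∈-subsets⁻ : ∀ {n} (r u : Vec Bool n) → r ∈ subsets u → r ⊑ u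
∈-subsets⁻ r (false ∷ u) r∈ j rⱼ with ∈-map⁻ (false Vec.∷_) r∈
∈-subsets⁻ _ (false ∷ u) r∈ (suc j) rⱼ | r , r∈′ , refl = ∈-subsets⁻ r u r∈′ j rⱼ
∈-subsets⁻ r (true ∷ u) r∈ zero    rⱼ = refl
∈-subsets⁻ r (true ∷ u) r∈ (suc j) rⱼ with ∈-++⁻ (map (false Vec.∷_) (subsets u)) r∈
... | inj₁ r∈ˡ with r , r∈′ , refl ← ∈-map⁻ (false Vec.∷_) r∈ˡ = ∈-subsets⁻ r u r∈′ j rⱼ
... | inj₂ r∈ʳ with r , r∈′ , refl ← ∈-map⁻ (true Vec.∷_) r∈ʳ  = ∈-subsets⁻ r u r∈′ j rⱼ

subsets-unique : ∀ {n} (u : Vec Bool n) → Unique (subsets u)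
subsets-unique []          = [] ∷ []
subsets-unique (false ∷ u) = Unique.map⁺ Vec.∷-injectiveʳ (subsets-unique u)
subsets-unique (true ∷ u)  =
  Unique.++⁺ (Unique.map⁺ Vec.∷-injectiveʳ (subsets-unique u))
             (Unique.map⁺ Vec.∷-injectiveʳ (subsets-unique u)) disjoint
  where
  disjoint : ∀ {r} → ¬ (r ∈ map (false Vec.∷_) (subsets u) × r ∈ map (true Vec.∷_) (subsets u))
  disjoint (r∈ˡ , r∈ʳ)
    with _ , _ , refl ← ∈-map⁻ (false Vec.∷_) r∈ˡ | _ , _ , () ← ∈-map⁻ (true Vec.∷_) r∈ʳ

extensions : ∀ {n} → Graph n → List (Graph (suc n))
extensions G = map (λ r → addFirst r G) (subsets (uncovered G))

noncrossingGraphs : ∀ n → List (Graph n)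
noncrossingGraphs zero    = [ mkGraph [] (λ ()) (λ ()) ]
noncrossingGraphs (suc n) = concatMap extensions (noncrossingGraphs n)

∈-extensions⁻ : ∀ {n} {G : Graph n} {H} → H ∈ extensions G → dropFirst H ≡ G × firstRow H ⊑ uncovered G
∈-extensions⁻ {G = G} H∈ with r , r∈ , refl ← ∈-map⁻ (λ r → addFirst r G) H∈ =
  dropFirst-addFirst r G ,
  subst (_⊑ uncovered G) (sym (firstRow-addFirst r G)) (∈-subsets⁻ r (uncovered G) r∈)

∈-noncrossingGraphs⁺ : ∀ {n} (G : Graph n) → NonCrossing G → G ∈ noncrossingGraphs n
∈-noncrossingGraphs⁺ {zero}  (mkGraph [] _ _) nc = here refl
∈-noncrossingGraphs⁺ {suc n} G nc =
  let nc′ , row = to (noncrossing⇔ G) nc in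
  ∈-concatMap⁺ extensions (Any.map (λ { refl → G∈ row }) (∈-noncrossingGraphs⁺ (dropFirst G) nc′))
  where
  G∈ : firstRow G ⊑ uncovered (dropFirst G) → G ∈ extensions (dropFirst G)
  G∈ row = subst (_∈ extensions (dropFirst G)) (addFirst-firstRow-dropFirst G)
    (∈-map⁺ (λ r → addFirst r (dropFirst G)) (∈-subsets⁺ (firstRow G) (uncovered (dropFirst G)) row))

∈-noncrossingGraphs⁻ : ∀ {n} (G : Graph n) → G ∈ noncrossingGraphs n → NonCrossing G
∈-noncrossingGraphs⁻ {zero}  G G∈ ()
∈-noncrossingGraphs⁻ {suc n} G G∈
  with H , H∈ , G∈ext ← find (∈-concatMap⁻ extensions {xs = noncrossingGraphs n} G∈)
  with refl , row ← ∈-extensions⁻ {G = H} G∈ext =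
  from (noncrossing⇔ G) (∈-noncrossingGraphs⁻ H H∈ , row)

noncrossingGraphs-unique : ∀ n → Unique (noncrossingGraphs n)
noncrossingGraphs-unique zero    = [] ∷ []
noncrossingGraphs-unique (suc n) = Unique.concat⁺
  (All.map⁺ (All.universal (λ G → Unique.map⁺ (addFirst-injective G) (subsets-unique (uncovered G))) _))
  (AllPairs.map⁺ (AllPairs.map disjoint (noncrossingGraphs-unique n)))
  where
  addFirst-injective : ∀ {n} (G : Graph n) {r s} → addFirst r G ≡ addFirst s G → r ≡ s
  addFirst-injective G {r} {s} eq =
    trans (sym (firstRow-addFirst r G)) (trans (cong firstRow eq) (firstRow-addFirst s G))

  disjoint : ∀ {G H : Graph n} → G ≢ H → ∀ {K} → ¬ (K ∈ extensions G × K ∈ extensions H)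
  disjoint {G} {H} G≢H (K∈G , K∈H) =
    G≢H (trans (sym (proj₁ (∈-extensions⁻ {G = G} K∈G))) (proj₁ (∈-extensions⁻ {G = H} K∈H)))

-- Counting noncrossing graphs by their number of uncovered vertices

∑ : ∀ {a} {A : Set a} → List A → (A → ℕ) → ℕ
∑ xs f = sum (map f xs)

∑-++ : ∀ {a} {A : Set a} (xs ys : List A) f → ∑ (xs ++ ys) f ≡ ∑ xs f + ∑ ys f
∑-++ xs ys f = trans (cong sum (map-++ f xs ys)) (sum-++ (map f xs) (map f ys))

∑-map : ∀ {a b} {A : Set a} {B : Set b} (g : A → B) xs f → ∑ (map g xs) f ≡ ∑ xs (f ∘ g)
∑-map g xs f = cong sum (sym (map-∘ xs))

∑-concatMap : ∀ {a b} {A : Set a} {B : Set b} (g : A → List B) xs f →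
              ∑ (concatMap g xs) f ≡ ∑ xs (λ x → ∑ (g x) f)
∑-concatMap g []       f = refl
∑-concatMap g (x ∷ xs) f =
  trans (∑-++ (g x) (concatMap g xs) f) (cong (λ s → ∑ (g x) f + s) (∑-concatMap g xs f))

∑-cong : ∀ {a} {A : Set a} (xs : List A) {f g} → (∀ x → f x ≡ g x) → ∑ xs f ≡ ∑ xs g
∑-cong xs eq = cong sum (map-cong eq xs)

-- The sum of 2ʷ⁻ᵗ φ(t) over t from 1 to w: here t counts the uncovered vertices from the last
-- chosen one onwards, and the w - t earlier ones are chosen freely.
nonemptySum : (ℕ → ℕ) → ℕ → ℕ
nonemptySum φ zero    = 0
nonemptySum φ (suc w) = φ (suc w) + 2 * nonemptySum φ w

-- The Boolean argument of `h` is what carries the induction: a leading uncovered vertex survives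
-- exactly when no neighbour is chosen after it, so `h` has to change differently for an empty and a
-- nonempty rest (`h₀`, `h₁`).
∑-subsets : ∀ {n} (u : Vec Bool n) (h : Bool → ℕ → ℕ) →
            ∑ (subsets u) (λ r → h (nonempty r) ∣ remaining r u ∣) ≡
            (h false ∣ u ∣) + (nonemptySum (h true) ∣ u ∣)
∑-subsets []          h = refl
∑-subsets (false ∷ u) h = trans (∑-map (false Vec.∷_) (subsets u) _) (∑-subsets u h)
∑-subsets (true ∷ u)  h = begin
  ∑ (map (false Vec.∷_) (subsets u) ++ map (true Vec.∷_) (subsets u)) f
    ≡⟨ ∑-++ (map (false Vec.∷_) (subsets u)) _ f ⟩
  ∑ (map (false Vec.∷_) (subsets u)) f + ∑ (map (true Vec.∷_) (subsets u)) f
    ≡⟨ cong₂ _+_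
         (trans (∑-map (false Vec.∷_) (subsets u) f)
           (trans (∑-cong (subsets u) excluding) (∑-subsets u h₀)))
         (trans (∑-map (true Vec.∷_) (subsets u) f)
           (trans (∑-cong (subsets u) including) (∑-subsets u h₁))) ⟩
  (h false (suc w) + nonemptySum (h true) w) + (h true (suc w) + nonemptySum (h true) w)
    ≡⟨ solve 3 (λ a b m → (a :+ m) :+ (b :+ m) := a :+ (b :+ con 2 :* m)) refl
         (h false (suc w)) (h true (suc w)) (nonemptySum (h true) w) ⟩
  h false (suc w) + (h true (suc w) + 2 * nonemptySum (h true) w)
    ∎
  where
  open ℕ-Solver
  w = ∣ u ∣
  f : Vec Bool _ → ℕ
  f r = h (nonempty r) ∣ remaining r (true ∷ u) ∣
  h₀ h₁ : Bool → ℕ → ℕ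
  h₀ b k = h b (if b then k else suc k)
  h₁ b k = h true (if b then k else suc k)

  excluding : ∀ r → f (false ∷ r) ≡ h₀ (nonempty r) ∣ remaining r u ∣
  excluding r with nonempty r
  ... | true  = refl
  ... | false = refl

  including : ∀ r → f (true ∷ r) ≡ h₁ (nonempty r) ∣ remaining r u ∣
  including r with nonempty r
  ... | true  = refl
  ... | false = refl

weight : ∀ {n} → Graph n → ℕ
weight G = ∣ uncovered G ∣

weight-addFirst : ∀ {n} r (G : Graph n) → weight (addFirst r G) ≡ suc ∣ remaining r (uncovered G) ∣
weight-addFirst r G =
  cong₂ (λ s H → suc ∣ remaining s (uncovered H) ∣) (firstRow-addFirst r G) (dropFirst-addFirst r G)

total : ∀ n → (ℕ → ℕ) → ℕ
total n φ = ∑ (noncrossingGraphs n) (φ ∘ weight)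

total-suc : ∀ n φ → total (suc n) φ ≡ total n (λ w → φ (suc w) + nonemptySum (φ ∘ suc) w)
total-suc n φ = trans (∑-concatMap extensions (noncrossingGraphs n) (φ ∘ weight))
  (∑-cong (noncrossingGraphs n) λ G →
    trans (∑-map (λ r → addFirst r G) (subsets (uncovered G)) (φ ∘ weight))
    (trans (∑-cong (subsets (uncovered G)) λ r → cong φ (weight-addFirst r G))
           (∑-subsets (uncovered G) (λ _ w → φ (suc w)))))

-- With `≡ᵇ`, `δ (suc k) (suc w)` reduces to `δ k w`, and the decision `k ℕ.≟ w` used for filtering
-- computes by the same test.
δ : ℕ → ℕ → ℕ
δ k w = if k ≡ᵇ w then 1 else 0

count : ℕ → ℕ → ℕ
count n k = total n (δ k)

-- The values are powers of two that double whenever the target weight drops by one. The index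
-- starts at 1 because the last neighbour always survives and the value at 0 is zero.
nonemptySum-δ : ∀ k w → nonemptySum (δ (suc k)) w ≡ δ (suc k) w + 2 * nonemptySum (δ (suc (suc k))) w
nonemptySum-δ k zero    = refl
nonemptySum-δ k (suc w) = begin
  δ k w + 2 * nonemptySum (δ (suc k)) w
    ≡⟨ cong (λ s → δ k w + 2 * s) (nonemptySum-δ k w) ⟩
  δ k w + 2 * (δ (suc k) w + 2 * nonemptySum (δ (suc (suc k))) w)
    ∎

-- The identity already holds for the extensions of each single graph (`pointwise`), where the
-- geometric tails cancel; summing over all graphs gives the claim. The negative term is moved
-- across to stay in ℕ.
count-recurrence : ∀ n k → count (suc n) (2 + k) + 2 * count n (2 + k) ≡
                           2 * count (suc n) (3 + k) + 2 * count n (1 + k)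
count-recurrence n k = begin
  count (suc n) (2 + k) + 2 * count n (2 + k)
    ≡⟨ cong (_+ 2 * count n (2 + k)) (total-suc n (δ (2 + k))) ⟩
  total n f + 2 * count n (2 + k)
    ≡⟨ sums (noncrossingGraphs n) ⟩
  2 * total n g + 2 * count n (1 + k)
    ≡⟨ cong (λ s → 2 * s + 2 * count n (1 + k)) (total-suc n (δ (3 + k))) ⟨
  2 * count (suc n) (3 + k) + 2 * count n (1 + k)
    ∎
  where
  open ℕ-Solver
  f g : ℕ → ℕ
  f w = δ (1 + k) w + nonemptySum (δ (1 + k)) w
  g w = δ (2 + k) w + nonemptySum (δ (2 + k)) w

  pointwise : ∀ w → f w + 2 * δ (2 + k) w ≡ 2 * g w + 2 * δ (1 + k) w
  pointwise w rewrite nonemptySum-δ k w =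
    solve 3 (λ x y m → x :+ (x :+ con 2 :* m) :+ con 2 :* y := con 2 :* (y :+ m) :+ con 2 :* x) refl
      (δ (1 + k) w) (δ (2 + k) w) (nonemptySum (δ (2 + k)) w)

  sums : ∀ Gs → ∑ Gs (f ∘ weight) + 2 * ∑ Gs (δ (2 + k) ∘ weight) ≡
                2 * ∑ Gs (g ∘ weight) + 2 * ∑ Gs (δ (1 + k) ∘ weight)
  sums []       = refl
  sums (G ∷ Gs) = begin
    f w + F + 2 * (δ (2 + k) w + Y)
      ≡⟨ solve 4 (λ a b c d → a :+ b :+ con 2 :* (c :+ d) := (a :+ con 2 :* c) :+ (b :+ con 2 :* d))
           refl (f w) F (δ (2 + k) w) Y ⟩
    (f w + 2 * δ (2 + k) w) + (F + 2 * Y)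
      ≡⟨ cong₂ _+_ (pointwise w) (sums Gs) ⟩
    (2 * g w + 2 * δ (1 + k) w) + (2 * H + 2 * X)
      ≡⟨ solve 4 (λ a b c d → (con 2 :* a :+ con 2 :* b) :+ (con 2 :* c :+ con 2 :* d) :=
                              con 2 :* (a :+ c) :+ con 2 :* (b :+ d)) refl (g w) (δ (1 + k) w) H X ⟩
    2 * (g w + H) + 2 * (δ (1 + k) w + X)
      ∎
    where
    w = weight G
    F = ∑ Gs (f ∘ weight)
    Y = ∑ Gs (δ (2 + k) ∘ weight)
    H = ∑ Gs (g ∘ weight)
    X = ∑ Gs (δ (1 + k) ∘ weight)

∑-zero : ∀ {a} {A : Set a} (xs : List A) {f} → (∀ x → f x ≡ 0) → ∑ xs f ≡ 0
∑-zero []       f≡0 = refl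
∑-zero (x ∷ xs) f≡0 = cong₂ _+_ (f≡0 x) (∑-zero xs f≡0)

count-large : ∀ {n k} → n < k → count n k ≡ 0
count-large {n} {k} n<k = ∑-zero (noncrossingGraphs n) λ G → δ-> (ℕ.≤-<-trans (∣p∣≤n (uncovered G)) n<k)
  where
  δ-> : ∀ {k w} → w < k → δ k w ≡ 0
  δ-> {suc k} {zero}  (s≤s _)   = refl
  δ-> {suc k} {suc w} (s≤s w<k) = δ-> w<k

count-0 : ∀ n → count (suc n) 0 ≡ 0
count-0 n = trans (total-suc n (δ 0)) (∑-zero (noncrossingGraphs n) λ G → vanish (weight G))
  where
  vanish : ∀ w → nonemptySum (λ _ → 0) w ≡ 0
  vanish zero    = refl
  vanish (suc w) = cong (2 *_) (vanish w)

count-1 : ∀ n → count (suc n) 1 ≡ count n 0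
count-1 n = trans (total-suc n (δ 1)) (∑-cong (noncrossingGraphs n) λ G →
    trans (cong (λ s → δ 0 (weight G) + s) (vanish (weight G))) (ℕ.+-identityʳ _))
  where
  vanish : ∀ w → nonemptySum (δ 0) w ≡ 0
  vanish zero    = refl
  vanish (suc w) = cong (2 *_) (vanish w)

length-filter : ∀ {a} {A : Set a} (f : A → ℕ) k xs → length (filter (λ x → k ℕ.≟ f x) xs) ≡ ∑ xs (δ k ∘ f)
length-filter f k []       = refl
length-filter f k (x ∷ xs) with k ≡ᵇ f x
... | true  = cong suc (length-filter f k xs)
... | false = length-filter f k xs

members : ∀ {n} → Vec Bool n → List (Fin n)
members []          = []
members (false ∷ u) = map suc (members u)
members (true ∷ u)  = zero ∷ map suc (members u)

length-members : ∀ {n} (u : Vec Bool n) → length (members u) ≡ ∣ u ∣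
length-members []          = refl
length-members (false ∷ u) = trans (length-map suc (members u)) (length-members u)
length-members (true ∷ u)  = cong suc (trans (length-map suc (members u)) (length-members u))

members-unique : ∀ {n} (u : Vec Bool n) → Unique (members u)
members-unique []          = []
members-unique (false ∷ u) = Unique.map⁺ Fin.suc-injective (members-unique u)
members-unique (true ∷ u)  =
  All.map⁺ (All.universal (λ _ ()) (members u)) ∷ Unique.map⁺ Fin.suc-injective (members-unique u)

∈-members⇔ : ∀ {n} (u : Vec Bool n) i → i ∈ members u ⇔ lookup u i ≡ true
∈-members⇔ u i = mk⇔ (sound u i) (complete u i)
  where
  sound : ∀ {n} (u : Vec Bool n) i → i ∈ members u → lookup u i ≡ true
  sound (true ∷ u)  zero    _  = refl
  sound (true ∷ u)  (suc i) (there i∈) with _ , i∈′ , refl ← ∈-map⁻ suc i∈ = sound u i i∈′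
  sound (false ∷ u) i       i∈ with j , j∈ , refl ← ∈-map⁻ suc i∈ = sound u j j∈

  complete : ∀ {n} (u : Vec Bool n) i → lookup u i ≡ true → i ∈ members u
  complete (true ∷ u)  zero    _  = here refl
  complete (true ∷ u)  (suc i) uᵢ = there (∈-map⁺ suc (complete u i uᵢ))
  complete (false ∷ u) (suc i) uᵢ = ∈-map⁺ suc (complete u i uᵢ)

-- Coefficients of powers of (2 - y) / (1 - y)

open ℤ-Solver

-- The coefficient of a Cauchy product. Recursion shifts `g`, so the terms appear in increasing
-- index of `g`, the order of the final sum over k.
convolution : (ℕ → ℤ) → (ℕ → ℤ) → ℕ → ℤ
convolution f g zero    = f 0 ℤ.* g 0
convolution f g (suc m) = f (suc m) ℤ.* g 0 ℤ.+ convolution f (g ∘ suc) m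

convolution-zeroʳ : ∀ f {g} → (∀ i → g i ≡ 0ℤ) → ∀ m → convolution f g m ≡ 0ℤ
convolution-zeroʳ f g≡0 zero    = trans (cong (f 0 ℤ.*_) (g≡0 0)) (ℤ.*-zeroʳ (f 0))
convolution-zeroʳ f g≡0 (suc m) = cong₂ ℤ._+_
  (trans (cong (f (suc m) ℤ.*_) (g≡0 0)) (ℤ.*-zeroʳ (f (suc m))))
  (convolution-zeroʳ f (g≡0 ∘ suc) m)

convolution-+ʳ : ∀ f {g h k} → (∀ i → g i ≡ h i ℤ.+ k i) →
                 ∀ m → convolution f g m ≡ convolution f h m ℤ.+ convolution f k m
convolution-+ʳ f {g} {h} {k} g≡ zero    =
  trans (cong (f 0 ℤ.*_) (g≡ 0)) (ℤ.*-distribˡ-+ (f 0) (h 0) (k 0))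
convolution-+ʳ f {g} {h} {k} g≡ (suc m) = trans
  (cong₂ (λ x y → f (suc m) ℤ.* x ℤ.+ y) (g≡ 0) (convolution-+ʳ f (g≡ ∘ suc) m))
  (solve 5 (λ f x y u v → f :* (x :+ y) :+ (u :+ v) := (f :* x :+ u) :+ (f :* y :+ v)) refl
    (f (suc m)) (h 0) (k 0) (convolution f (h ∘ suc) m) (convolution f (k ∘ suc) m))

-- The hypotheses say that g and h have generating functions G and (1 - y) G.
convolution-divide : ∀ f g h → g 0 ≡ h 0 → (∀ i → g (suc i) ≡ g i ℤ.+ h (suc i)) →
  ∀ m → convolution f g (suc m) ≡ convolution f g m ℤ.+ convolution f h (suc m)
convolution-divide f g h g₀ gₛ m = trans
  (cong₂ (λ x y → f (suc m) ℤ.* x ℤ.+ y) g₀ (convolution-+ʳ f gₛ m))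
  (solve 3 (λ x y z → x :+ (y :+ z) := y :+ (x :+ z)) refl
    (f (suc m) ℤ.* h 0) (convolution f g m) (convolution f (h ∘ suc) m))

-- The hypotheses say that f and f′ have generating functions Φ and (2 - y) Φ.
convolution-multiply : ∀ f f′ g → f′ 0 ≡ + 2 ℤ.* f 0 →
  (∀ s → f′ (suc s) ≡ + 2 ℤ.* f (suc s) ℤ.- f s) →
  ∀ m → convolution f′ g (suc m) ≡ + 2 ℤ.* convolution f g (suc m) ℤ.- convolution f g m
convolution-multiply f f′ g f₀ fₛ zero = trans
  (cong₂ (λ x y → x ℤ.* g 0 ℤ.+ y ℤ.* g 1) (fₛ 0) f₀)
  (solve 4 (λ x y u v → (con (+ 2) :* y :- x) :* u :+ con (+ 2) :* x :* v :=
                        con (+ 2) :* (y :* u :+ x :* v) :- x :* u) refl (f 0) (f 1) (g 0) (g 1))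
convolution-multiply f f′ g f₀ fₛ (suc m) = trans
  (cong₂ (λ x y → x ℤ.* g 0 ℤ.+ y) (fₛ (suc m)) (convolution-multiply f f′ (g ∘ suc) f₀ fₛ m))
  (solve 5 (λ x y u v w → (con (+ 2) :* y :- x) :* u :+ (con (+ 2) :* v :- w) :=
                          con (+ 2) :* (y :* u :+ v) :- (x :* u :+ w)) refl
    (f (suc m)) (f (suc (suc m))) (g 0) (convolution f (g ∘ suc) (suc m)) (convolution f (g ∘ suc) m))

-- numerator N s = [yˢ] (2 - y)ᴺ and denominator N i = [yⁱ] (1 - y)⁻ᴺ.
numerator : ℕ → ℕ → ℤ
numerator zero    zero    = 1ℤ
numerator zero    (suc s) = 0ℤ
numerator (suc N) zero    = + 2 ℤ.* numerator N zero
numerator (suc N) (suc s) = + 2 ℤ.* numerator N (suc s) ℤ.- numerator N s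

denominator : ℕ → ℕ → ℤ
denominator zero    zero    = 1ℤ
denominator zero    (suc i) = 0ℤ
denominator (suc N) zero    = denominator N zero
denominator (suc N) (suc i) = denominator (suc N) i ℤ.+ denominator N (suc i)

-- coefficient N m = [yᵐ] ((2 - y) / (1 - y))ᴺ.
coefficient : ℕ → ℕ → ℤ
coefficient N = convolution (numerator N) (denominator N)

coefficient-0-suc : ∀ m → coefficient 0 (suc m) ≡ 0ℤ
coefficient-0-suc m = trans (ℤ.+-identityˡ _) (convolution-zeroʳ (numerator 0) (λ _ → refl) m)

coefficient-suc-0 : ∀ N → coefficient (suc N) 0 ≡ + 2 ℤ.* coefficient N 0
coefficient-suc-0 N = ℤ.*-assoc (+ 2) (numerator N 0) (denominator N 0)

-- The coefficient of yᵐ⁺¹ in (1 - y) ψᴺ⁺¹ = (2 - y) ψᴺ: one more factor in the denominator, one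
-- more in the numerator.
coefficient-suc-suc : ∀ N m → coefficient (suc N) (suc m) ≡
  coefficient (suc N) m ℤ.+ (+ 2 ℤ.* coefficient N (suc m) ℤ.- coefficient N m)
coefficient-suc-suc N m = trans
  (convolution-divide (numerator (suc N)) (denominator (suc N)) (denominator N) refl (λ _ → refl) m)
  (cong (λ x → coefficient (suc N) m ℤ.+ x)
    (convolution-multiply (numerator N) (numerator (suc N)) (denominator N) refl (λ _ → refl) m))

-- With ψ = (2 - y) / (1 - y), this is the coefficient of yᵐ in
-- N ψᴺ⁺¹ - (2 - y) (ψᴺ)′ - N ψᴺ, which vanishes because ψ² = (2 - y) ψ′ + ψ.
defect : ℕ → ℕ → ℤ
defect N m = + N ℤ.* coefficient (suc N) m ℤ.- + 2 ℤ.* + suc m ℤ.* coefficient N (suc m)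
               ℤ.- (+ N ℤ.- + m) ℤ.* coefficient N m

defect-suc-0 : ∀ N → defect (suc N) 0 ≡ + 2 ℤ.* defect N 0
defect-suc-0 N
  rewrite coefficient-suc-suc N 0 | coefficient-suc-0 (suc N) | coefficient-suc-0 N =
  solve 3 (λ n f g →
    (con (+ 1) :+ n) :* (con (+ 2) :* (con (+ 2) :* f))
      :- con (+ 2) :* con (+ 1) :* (con (+ 2) :* f :+ (con (+ 2) :* g :- f))
      :- (con (+ 1) :+ n :- con (+ 0)) :* (con (+ 2) :* f) :=
    con (+ 2) :* (n :* (con (+ 2) :* f) :- con (+ 2) :* con (+ 1) :* g :- (n :- con (+ 0)) :* f))
    refl (+ N) (coefficient N 0) (coefficient N 1)

-- Let D_N be the series of defects. Differentiating (1 - y) ψᴺ⁺¹ = (2 - y) ψᴺ and substituting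
-- gives (1 - y) D_(N+1) = (2 - y) D_N, the same recurrence as for the powers of ψ; vanishing is
-- thus inherited from N = 0.
defect-suc-suc : ∀ N m → defect (suc N) (suc m) ≡
                 defect (suc N) m ℤ.+ (+ 2 ℤ.* defect N (suc m) ℤ.- defect N m)
defect-suc-suc N m
  rewrite coefficient-suc-suc (suc N) m | coefficient-suc-suc N (suc m) | coefficient-suc-suc N m =
  solve 7 (λ n m s p a b c →
    let q = p :+ (con (+ 2) :* b :- a) ; r = q :+ (con (+ 2) :* c :- b)
        n+1 = con (+ 1) :+ n ; m+1 = con (+ 1) :+ m ; m+2 = con (+ 2) :+ m in
    n+1 :* (s :+ (con (+ 2) :* q :- p)) :- con (+ 2) :* m+2 :* r :- (n+1 :- m+1) :* q :=
    n+1 :* s :- con (+ 2) :* m+1 :* q :- (n+1 :- m) :* p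
      :+ (con (+ 2) :* (n :* q :- con (+ 2) :* m+2 :* c :- (n :- m+1) :* b)
          :- (n :* p :- con (+ 2) :* m+1 :* b :- (n :- m) :* a)))
    refl (+ N) (+ m) (coefficient (suc (suc N)) m) (coefficient (suc N) m)
    (coefficient N m) (coefficient N (suc m)) (coefficient N (suc (suc m)))

defect-vanishes : ∀ N m → defect N m ≡ 0ℤ
defect-vanishes zero    zero    = refl
defect-vanishes zero    (suc m) = trans
  (cong₂ (λ x y → 0ℤ ℤ.* coefficient 1 (suc m) ℤ.- + 2 ℤ.* + suc (suc m) ℤ.* x ℤ.- (0ℤ ℤ.- + suc m) ℤ.* y)
    (coefficient-0-suc (suc m)) (coefficient-0-suc m))
  (solve 3 (λ x y z → con 0ℤ :* x :- y :* con 0ℤ :- z :* con 0ℤ := con 0ℤ) refl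
    (coefficient 1 (suc m)) (+ 2 ℤ.* + suc (suc m)) (0ℤ ℤ.- + suc m))
defect-vanishes (suc N) zero    = trans (defect-suc-0 N) (cong (λ x → + 2 ℤ.* x) (defect-vanishes N 0))
defect-vanishes (suc N) (suc m) = begin
  defect (suc N) (suc m)                                             ≡⟨ defect-suc-suc N m ⟩
  defect (suc N) m ℤ.+ (+ 2 ℤ.* defect N (suc m) ℤ.- defect N m)
    ≡⟨ cong₂ ℤ._+_ (defect-vanishes (suc N) m)
         (cong₂ (λ x y → + 2 ℤ.* x ℤ.- y) (defect-vanishes N (suc m)) (defect-vanishes N m)) ⟩
  0ℤ                                                                 ∎

-- The numbers `v N j`, on N + 1 points with j + 1 visible vertices, and their solution

v : ℕ → ℕ → ℤ
v N j = + count (suc N) (suc j)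

v-recurrence : ∀ N k → v (suc N) (suc k) ≡
  + 2 ℤ.* v (suc N) (suc (suc k)) ℤ.+ + 2 ℤ.* v N k ℤ.- + 2 ℤ.* v N (suc k)
v-recurrence N k = begin
  x
    ≡⟨ solve 2 (λ x y → x := (x :+ y) :- y) refl x (+ 2 ℤ.* v N (suc k)) ⟩
  x ℤ.+ + 2 ℤ.* v N (suc k) ℤ.- + 2 ℤ.* v N (suc k)
    ≡⟨ cong (ℤ._- + 2 ℤ.* v N (suc k)) positive-form ⟩
  + 2 ℤ.* v (suc N) (suc (suc k)) ℤ.+ + 2 ℤ.* v N k ℤ.- + 2 ℤ.* v N (suc k)
    ∎
  where
  x : ℤ
  x = v (suc N) (suc k)

  pos-+2* : ∀ a b → + a ℤ.+ + 2 ℤ.* + b ≡ + (a + 2 * b)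
  pos-+2* a b = trans (cong (λ x → + a ℤ.+ x) (sym (ℤ.pos-* 2 b))) (sym (ℤ.pos-+ a (2 * b)))

  positive-form : x ℤ.+ + 2 ℤ.* v N (suc k) ≡ + 2 ℤ.* v (suc N) (suc (suc k)) ℤ.+ + 2 ℤ.* v N k
  positive-form = begin
    x ℤ.+ + 2 ℤ.* v N (suc k)
      ≡⟨ pos-+2* (count (2 + N) (2 + k)) (count (suc N) (2 + k)) ⟩
    + (count (2 + N) (2 + k) + 2 * count (suc N) (2 + k))
      ≡⟨ cong +_ (count-recurrence (suc N) k) ⟩
    + (2 * count (2 + N) (3 + k) + 2 * count (suc N) (1 + k))
      ≡⟨ pos-+2* (2 * count (2 + N) (3 + k)) (count (suc N) (1 + k)) ⟨
    + (2 * count (2 + N) (3 + k)) ℤ.+ + 2 ℤ.* v N k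
      ≡⟨ cong (ℤ._+ + 2 ℤ.* v N k) (ℤ.pos-* 2 (count (2 + N) (3 + k))) ⟩
    + 2 ℤ.* v (suc N) (suc (suc k)) ℤ.+ + 2 ℤ.* v N k
      ∎

v-large : ∀ {N j} → N < j → v N j ≡ 0ℤ
v-large N<j = cong +_ (count-large (s≤s N<j))

-- With at least two vertices, the first and the last are both uncovered.
v-0 : ∀ N → v (suc N) 0 ≡ 0ℤ
v-0 N = cong +_ (trans (count-1 (suc N)) (count-0 N))

power : ℕ → ℤ
power m = + (2 ^ m)

-- The recurrence expresses a value through the next larger `j` at the same number of points and
-- through one point fewer. The induction therefore runs upwards in `m`, starting on the diagonal
-- `m = 0`.
lagrange : ∀ N j m → j + m ≡ suc N →
           + suc N ℤ.* v (suc N) j ≡ + j ℤ.* (power m ℤ.* coefficient (suc N) m)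
lagrange N zero m eq = begin
  + suc N ℤ.* v (suc N) 0     ≡⟨ cong (λ x → + suc N ℤ.* x) (v-0 N) ⟩
  + suc N ℤ.* 0ℤ              ≡⟨ ℤ.*-zeroʳ (+ suc N) ⟩
  0ℤ                          ≡⟨ ℤ.*-zeroˡ (power m ℤ.* coefficient (suc N) m) ⟨
  0ℤ ℤ.* (power m ℤ.* coefficient (suc N) m) ∎
lagrange zero (suc zero) zero eq = refl
lagrange (suc N) (suc k) zero eq
  with refl ← trans (sym (ℕ.+-identityʳ k)) (ℕ.suc-injective eq) =
  ℤ.*-cancelˡ-≡ (+ suc N) _ _ (begin
    n ℤ.* (n+1 ℤ.* v (suc (suc N)) (suc k))
      ≡⟨ cong (λ x → n ℤ.* (n+1 ℤ.* x)) (v-recurrence (suc N) k) ⟩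
    n ℤ.* (n+1 ℤ.* (+ 2 ℤ.* v (2 + N) (2 + k) ℤ.+ + 2 ℤ.* v (suc N) k ℤ.- + 2 ℤ.* v (suc N) (suc k)))
      -- On the diagonal two of the three terms ask for more uncovered vertices than there are
      -- vertices.
      ≡⟨ cong₂ (λ x y → n ℤ.* (n+1 ℤ.* (+ 2 ℤ.* x ℤ.+ + 2 ℤ.* v (suc N) k ℤ.- + 2 ℤ.* y)))
           (v-large (ℕ.n<1+n (suc (suc N)))) (v-large (ℕ.n<1+n (suc N))) ⟩
    n ℤ.* (n+1 ℤ.* (+ 2 ℤ.* 0ℤ ℤ.+ + 2 ℤ.* v (suc N) k ℤ.- + 2 ℤ.* 0ℤ))
      ≡⟨ solve 3 (λ n n+1 x →
           n :* (n+1 :* (con (+ 2) :* con 0ℤ :+ con (+ 2) :* x :- con (+ 2) :* con 0ℤ)) :=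
           con (+ 2) :* n+1 :* (n :* x)) refl n n+1 (v (suc N) k) ⟩
    + 2 ℤ.* n+1 ℤ.* (n ℤ.* v (suc N) k)
      ≡⟨ cong (λ x → + 2 ℤ.* n+1 ℤ.* x) (lagrange N k zero (ℕ.+-identityʳ k)) ⟩
    + 2 ℤ.* n+1 ℤ.* (n ℤ.* (1ℤ ℤ.* coefficient (suc N) 0))
      ≡⟨ solve 3 (λ n n+1 x → con (+ 2) :* n+1 :* (n :* (con (+ 1) :* x)) :=
                              n :* (n+1 :* (con (+ 1) :* (con (+ 2) :* x)))) refl
           n n+1 (coefficient (suc N) 0) ⟩
    n ℤ.* (n+1 ℤ.* (1ℤ ℤ.* (+ 2 ℤ.* coefficient (suc N) 0)))
      ≡⟨ cong (λ x → n ℤ.* (n+1 ℤ.* (1ℤ ℤ.* x))) (coefficient-suc-0 (suc N)) ⟨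
    n ℤ.* (n+1 ℤ.* (1ℤ ℤ.* coefficient (suc (suc N)) 0)) ∎)
  where
  n n+1 : ℤ
  n = + suc N
  n+1 = + suc (suc N)
lagrange zero (suc k) (suc m) eq with () ← trans (sym (ℕ.+-suc k m)) (ℕ.suc-injective eq)
lagrange (suc N) (suc k) (suc m) eq =
  -- The induction hypotheses for one point fewer concern multiples by `n` only; this factor is
  -- supplied here and cancelled at the end.
  ℤ.*-cancelˡ-≡ n _ _ (ℤ.i-j≡0⇒i≡j _ _ (begin
    n ℤ.* (n+1 ℤ.* v (2 + N) (suc k)) ℤ.- n ℤ.* (j+1 ℤ.* (power (suc m) ℤ.* coefficient (2 + N) (suc m)))
      ≡⟨ cong₂ (λ x y → n ℤ.* (n+1 ℤ.* x) ℤ.- n ℤ.* (j+1 ℤ.* y)) (v-recurrence (suc N) k)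
           (cong₂ ℤ._*_ (ℤ.pos-* 2 (2 ^ m)) (coefficient-suc-suc (suc N) m)) ⟩
    n ℤ.* (n+1 ℤ.* (+ 2 ℤ.* x ℤ.+ + 2 ℤ.* y ℤ.- + 2 ℤ.* z)) ℤ.- n ℤ.* (j+1 ℤ.* (+ 2 ℤ.* P ℤ.* c))
      ≡⟨ solve 8 (λ n n+1 j+1 P c x y z →
           n :* (n+1 :* (con (+ 2) :* x :+ con (+ 2) :* y :- con (+ 2) :* z))
             :- n :* (j+1 :* (con (+ 2) :* P :* c)) :=
           con (+ 2) :* (n :* (n+1 :* x) :+ n+1 :* (n :* y) :- n+1 :* (n :* z) :- n :* (j+1 :* (P :* c))))
           refl n n+1 j+1 P c x y z ⟩
    + 2 ℤ.* (n ℤ.* (n+1 ℤ.* x) ℤ.+ n+1 ℤ.* (n ℤ.* y) ℤ.- n+1 ℤ.* (n ℤ.* z) ℤ.- n ℤ.* (j+1 ℤ.* (P ℤ.* c)))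
      ≡⟨ cong (λ s → + 2 ℤ.* (s ℤ.- n ℤ.* (j+1 ℤ.* (P ℤ.* c))))
           (cong₂ ℤ._-_
             (cong₂ (λ s t → n ℤ.* s ℤ.+ n+1 ℤ.* t)
               (lagrange (suc N) (2 + k) m (cong suc [1+k]+m))
               (trans (lagrange N k (suc m) k+[1+m]) (cong (λ q → j ℤ.* (q ℤ.* b)) (ℤ.pos-* 2 (2 ^ m)))))
             (cong (λ s → n+1 ℤ.* s) (lagrange N (suc k) m [1+k]+m))) ⟩
    balance n
      -- Only after `n` is replaced by `j + (1 + m)` is the difference, as a polynomial, a multiple
      -- of the defect.
      ≡⟨ cong balance n≡ ⟩
    balance (j ℤ.+ (1ℤ ℤ.+ + m))
      ≡⟨ solve 6 (λ j m P p b a →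
           let n = j :+ (con 1ℤ :+ m) ; n+1 = con 1ℤ :+ n ; j+1 = con 1ℤ :+ j in
           con (+ 2) :* (n :* ((con (+ 2) :+ j) :* (P :* p)) :+ n+1 :* (j :* (con (+ 2) :* P :* b))
             :- n+1 :* (j+1 :* (P :* a)) :- n :* (j+1 :* (P :* (p :+ (con (+ 2) :* b :- a))))) :=
           con (+ 2) :* P :* (n :* p :- con (+ 2) :* (con 1ℤ :+ m) :* b :- (n :- m) :* a))
           refl j (+ m) P p b a ⟩
    + 2 ℤ.* P ℤ.* (let n = j ℤ.+ (1ℤ ℤ.+ + m) in
      n ℤ.* p ℤ.- + 2 ℤ.* + suc m ℤ.* b ℤ.- (n ℤ.- + m) ℤ.* a)
      ≡⟨ cong (λ n → + 2 ℤ.* P ℤ.* (n ℤ.* p ℤ.- + 2 ℤ.* + suc m ℤ.* b ℤ.- (n ℤ.- + m) ℤ.* a)) n≡ ⟨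
    + 2 ℤ.* P ℤ.* defect (suc N) m
      ≡⟨ cong (λ x → + 2 ℤ.* P ℤ.* x) (defect-vanishes (suc N) m) ⟩
    + 2 ℤ.* P ℤ.* 0ℤ
      ≡⟨ ℤ.*-zeroʳ (+ 2 ℤ.* P) ⟩
    0ℤ ∎))
  where
  n n+1 j j+1 P p b a c x y z : ℤ
  n   = + suc N
  n+1 = + suc (suc N)
  j   = + k
  j+1 = + suc k
  P   = power m
  p   = coefficient (2 + N) m
  b   = coefficient (suc N) (suc m)
  a   = coefficient (suc N) m
  c   = p ℤ.+ (+ 2 ℤ.* b ℤ.- a)
  x   = v (2 + N) (2 + k)
  y   = v (suc N) k
  z   = v (suc N) (suc k)

  balance : ℤ → ℤ
  balance n = + 2 ℤ.* (n ℤ.* ((+ 2 ℤ.+ j) ℤ.* (P ℤ.* p)) ℤ.+ (1ℤ ℤ.+ n) ℤ.* (j ℤ.* (+ 2 ℤ.* P ℤ.* b))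
    ℤ.- (1ℤ ℤ.+ n) ℤ.* ((1ℤ ℤ.+ j) ℤ.* (P ℤ.* a)) ℤ.- n ℤ.* ((1ℤ ℤ.+ j) ℤ.* (P ℤ.* c)))

  k+[1+m] : k + suc m ≡ suc N
  k+[1+m] = ℕ.suc-injective eq

  [1+k]+m : suc k + m ≡ suc N
  [1+k]+m = trans (sym (ℕ.+-suc k m)) k+[1+m]

  n≡ : n ≡ j ℤ.+ (1ℤ ℤ.+ + m)
  n≡ = trans (cong +_ (sym k+[1+m])) (ℤ.pos-+ k (suc m))

-- Binomial closed forms and the alternating sum

numerator-large : ∀ {N s} → N < s → numerator N s ≡ 0ℤ
numerator-large {zero}  {suc s} _         = refl
numerator-large {suc N} {suc s} (s≤s N<s) =
  cong₂ (λ x y → + 2 ℤ.* x ℤ.- y) (numerator-large (ℕ.m<n⇒m<1+n N<s)) (numerator-large N<s)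

-- The binomial theorem for (2 - y)ᴺ, by Pascal's rule. The binomial is indexed by the exponent `t`
-- of 2, which becomes the k of the final sum.
numerator-closed : ∀ N s t → s + t ≡ N → numerator N s ≡ + (N C t) ℤ.* -1ℤ ℤ.^ s ℤ.* + (2 ^ t)
numerator-closed zero    zero    zero    eq = refl
numerator-closed (suc N) zero    (suc t) refl = begin
  + 2 ℤ.* numerator N 0
    ≡⟨ cong (λ x → + 2 ℤ.* x) (numerator-closed N 0 N refl) ⟩
  + 2 ℤ.* (+ (N C N) ℤ.* 1ℤ ℤ.* + (2 ^ N))
    ≡⟨ cong (λ c → + 2 ℤ.* (+ c ℤ.* 1ℤ ℤ.* + (2 ^ N))) (trans (nCn≡1 N) (sym (nCn≡1 (suc N)))) ⟩
  + 2 ℤ.* (+ (suc N C suc N) ℤ.* 1ℤ ℤ.* + (2 ^ N))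
    ≡⟨ solve 3 (λ t c p → t :* (c :* con 1ℤ :* p) := c :* con 1ℤ :* (t :* p)) refl
         (+ 2) (+ (suc N C suc N)) (+ (2 ^ N)) ⟩
  + (suc N C suc N) ℤ.* 1ℤ ℤ.* (+ 2 ℤ.* + (2 ^ N))
    ≡⟨ cong (λ p → + (suc N C suc N) ℤ.* 1ℤ ℤ.* p) (ℤ.pos-* 2 (2 ^ N)) ⟨
  + (suc N C suc N) ℤ.* 1ℤ ℤ.* + (2 ^ suc N)
    ∎
numerator-closed (suc N) (suc s) zero    eq
  with refl ← trans (sym (ℕ.+-identityʳ s)) (ℕ.suc-injective eq) = begin
  + 2 ℤ.* numerator N (suc N) ℤ.- numerator N N
    ≡⟨ cong₂ (λ x y → + 2 ℤ.* x ℤ.- y)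
         (numerator-large (ℕ.n<1+n N)) (numerator-closed N N 0 (ℕ.+-identityʳ N)) ⟩
  + 2 ℤ.* 0ℤ ℤ.- 1ℤ ℤ.* -1ℤ ℤ.^ N ℤ.* 1ℤ
    ≡⟨ solve 1 (λ x → con 0ℤ :- con 1ℤ :* x :* con 1ℤ := con 1ℤ :* (con -1ℤ :* x) :* con 1ℤ) refl
         (-1ℤ ℤ.^ N) ⟩
  1ℤ ℤ.* -1ℤ ℤ.^ suc N ℤ.* 1ℤ
    ∎
numerator-closed (suc N) (suc s) (suc t) eq = begin
  + 2 ℤ.* numerator N (suc s) ℤ.- numerator N s
    ≡⟨ cong₂ (λ x y → + 2 ℤ.* x ℤ.- y)
         (numerator-closed N (suc s) t (trans (sym (ℕ.+-suc s t)) (ℕ.suc-injective eq)))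
         (numerator-closed N s (suc t) (ℕ.suc-injective eq)) ⟩
  + 2 ℤ.* (x ℤ.* (-1ℤ ℤ.* p) ℤ.* q) ℤ.- y ℤ.* p ℤ.* + (2 ^ suc t)
    ≡⟨ cong (λ r → + 2 ℤ.* (x ℤ.* (-1ℤ ℤ.* p) ℤ.* q) ℤ.- y ℤ.* p ℤ.* r) (ℤ.pos-* 2 (2 ^ t)) ⟩
  + 2 ℤ.* (x ℤ.* (-1ℤ ℤ.* p) ℤ.* q) ℤ.- y ℤ.* p ℤ.* (+ 2 ℤ.* q)
    ≡⟨ solve 4 (λ x y p q → con (+ 2) :* (x :* (con -1ℤ :* p) :* q) :- y :* p :* (con (+ 2) :* q) :=
                            (x :+ y) :* (con -1ℤ :* p) :* (con (+ 2) :* q)) refl x y p q ⟩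
  (x ℤ.+ y) ℤ.* (-1ℤ ℤ.* p) ℤ.* (+ 2 ℤ.* q)
    ≡⟨ cong₂ (λ c r → c ℤ.* (-1ℤ ℤ.* p) ℤ.* r)
         (trans (sym (ℤ.pos-+ (N C t) (N C suc t))) (cong +_ (nCk+nC[k+1]≡[n+1]C[k+1] N t)))
         (sym (ℤ.pos-* 2 (2 ^ t))) ⟩
  + (suc N C suc t) ℤ.* -1ℤ ℤ.^ suc s ℤ.* + (2 ^ suc t) ∎
  where
  x y p q : ℤ
  x = + (N C t)
  y = + (N C suc t)
  p = -1ℤ ℤ.^ s
  q = + (2 ^ t)

denominator-0 : ∀ N → denominator N 0 ≡ 1ℤ
denominator-0 zero    = refl
denominator-0 (suc N) = denominator-0 N

-- The negative binomial series, again by Pascal's rule.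
denominator-closed : ∀ N i → denominator (suc N) i ≡ + ((N + i) C i)
denominator-closed N       zero    = denominator-0 N
denominator-closed zero    (suc i) = begin
  denominator 1 i ℤ.+ 0ℤ   ≡⟨ ℤ.+-identityʳ _ ⟩
  denominator 1 i          ≡⟨ denominator-closed zero i ⟩
  + (i C i)                ≡⟨ cong +_ (trans (nCn≡1 i) (sym (nCn≡1 (suc i)))) ⟩
  + (suc i C suc i)        ∎
denominator-closed (suc N) (suc i) = begin
  denominator (suc (suc N)) i ℤ.+ denominator (suc N) (suc i)
    ≡⟨ cong₂ ℤ._+_ (denominator-closed (suc N) i) (denominator-closed N (suc i)) ⟩
  + ((suc N + i) C i) ℤ.+ + ((N + suc i) C suc i)
    ≡⟨ cong (λ k → + ((suc N + i) C i) ℤ.+ + (k C suc i)) (ℕ.+-suc N i) ⟩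
  + ((suc N + i) C i) ℤ.+ + ((suc N + i) C suc i)
    ≡⟨ ℤ.pos-+ ((suc N + i) C i) ((suc N + i) C suc i) ⟨
  + ((suc N + i) C i + (suc N + i) C suc i)
    ≡⟨ cong +_ (nCk+nC[k+1]≡[n+1]C[k+1] (suc N + i) i) ⟩
  + ((suc (suc N) + i) C suc i)
    ≡⟨ cong (λ k → + (suc k C suc i)) (sym (ℕ.+-suc N i)) ⟩
  + ((suc N + suc i) C suc i) ∎

foldr-applyUpTo : ∀ f g h m → (∀ i s → s + i ≡ m → h i ≡ f s ℤ.* g i) →
                  foldr ℤ._+_ 0ℤ (applyUpTo h (suc m)) ≡ convolution f g m
foldr-applyUpTo f g h zero    h≡ = trans (ℤ.+-identityʳ (h 0)) (h≡ 0 0 refl)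
foldr-applyUpTo f g h (suc m) h≡ = cong₂ ℤ._+_ (h≡ 0 (suc m) (ℕ.+-identityʳ (suc m)))
  (foldr-applyUpTo f (g ∘ suc) (h ∘ suc) m λ i s eq → h≡ (suc i) s (trans (ℕ.+-suc s i) (cong suc eq)))

Σ-convolution : ∀ f g h {a b} m → a + m ≡ b → (∀ i s → s + i ≡ m → h (a + i) ≡ f s ℤ.* g i) →
                Σ[ a ≤k≤ b ] h ≡ convolution f g m
Σ-convolution f g h {a} {b} m refl h≡ = begin
  foldr ℤ._+_ 0ℤ (map h′ (upTo (suc (a + m) ∸ a)))
    ≡⟨ cong (λ k → foldr ℤ._+_ 0ℤ (map h′ (upTo k)))
         (trans (cong (_∸ a) (sym (ℕ.+-suc a m))) (ℕ.m+n∸m≡n a (suc m))) ⟩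
  foldr ℤ._+_ 0ℤ (map h′ (upTo (suc m)))
    ≡⟨ cong (foldr ℤ._+_ 0ℤ) (map-upTo h′ (suc m)) ⟩
  foldr ℤ._+_ 0ℤ (applyUpTo h′ (suc m))
    ≡⟨ foldr-applyUpTo f g h′ m h≡ ⟩
  convolution f g m ∎
  where
  h′ : ℕ → ℤ
  h′ i = h (a + i)

summand : ℕ → ℕ → ℕ → ℤ
summand n j k =
  + ((n ∸ 1) C k) ℤ.* + ((n + k ∸ j ∸ 2) C (k ∸ j)) ℤ.* -1ℤ ℤ.^ (n ∸ 1 ∸ k) ℤ.* + (2 ^ k)

-- With k = j + i and s = n - 1 - k, the sign, the power of 2 and the first binomial make up the
-- numerator coefficient at s; the second binomial is the denominator coefficient at i.
Σ-summand : ∀ N j m → j + m ≡ suc N → Σ[ j ≤k≤ suc N ] (summand (2 + N) j) ≡ coefficient (suc N) m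
Σ-summand N j m j+m =
  Σ-convolution (numerator (suc N)) (denominator (suc N)) (summand (2 + N) j) m j+m factors
  where
  factors : ∀ i s → s + i ≡ m → summand (2 + N) j (j + i) ≡ numerator (suc N) s ℤ.* denominator (suc N) i
  factors i s s+i = begin
    + (suc N C (j + i)) ℤ.* + ((suc (suc N) + (j + i) ∸ j ∸ 2) C (j + i ∸ j))
      ℤ.* -1ℤ ℤ.^ (suc N ∸ (j + i)) ℤ.* + (2 ^ (j + i))
      ≡⟨ cong₂ (λ c e → + (suc N C (j + i)) ℤ.* + c ℤ.* -1ℤ ℤ.^ e ℤ.* + (2 ^ (j + i)))
           (cong₂ _C_ top (ℕ.m+n∸m≡n j i)) exponent ⟩
    x ℤ.* y ℤ.* z ℤ.* w
      ≡⟨ solve 4 (λ x y z w → x :* y :* z :* w := x :* z :* w :* y) refl x y z w ⟩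
    x ℤ.* z ℤ.* w ℤ.* y
      ≡⟨ cong₂ ℤ._*_ (numerator-closed (suc N) s (j + i) s+[j+i]) (denominator-closed N i) ⟨
    numerator (suc N) s ℤ.* denominator (suc N) i ∎
    where
    x y z w : ℤ
    x = + (suc N C (j + i))
    y = + ((N + i) C i)
    z = -1ℤ ℤ.^ s
    w = + (2 ^ (j + i))
    s+[j+i] : s + (j + i) ≡ suc N
    s+[j+i] = begin
      s + (j + i)   ≡⟨ ℕ.+-assoc s j i ⟨
      s + j + i     ≡⟨ cong (_+ i) (ℕ.+-comm s j) ⟩
      j + s + i     ≡⟨ ℕ.+-assoc j s i ⟩
      j + (s + i)   ≡⟨ cong (λ k → j + k) s+i ⟩
      j + m         ≡⟨ j+m ⟩
      suc N         ∎
    exponent : suc N ∸ (j + i) ≡ s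
    exponent = trans (cong (_∸ (j + i)) (sym s+[j+i])) (ℕ.m+n∸n≡m s (j + i))
    top : suc (suc N) + (j + i) ∸ j ∸ 2 ≡ N + i
    top = cong (_∸ 2) (begin
      suc (suc N) + (j + i) ∸ j  ≡⟨ ℕ.+-∸-assoc (suc (suc N)) (ℕ.m≤m+n j i) ⟩
      suc (suc N) + (j + i ∸ j)  ≡⟨ cong (λ k → suc (suc N) + k) (ℕ.m+n∸m≡n j i) ⟩
      suc (suc N) + i            ∎)

-- Passing to unnormalised fractions avoids reduction to lowest terms and leaves one
-- cross-multiplication.
fraction-equation : ∀ N v j s → + suc N ℤ.* v ≡ j ℤ.* s → v / 1 ≡ (j / suc N) ℚ.* (s / 1)
fraction-equation N v j s eq = ℚ.toℚᵘ-injective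
  (ℚᵘ.≃-trans (ℚ.toℚᵘ-fromℚᵘ (mkℚᵘ v 0))
  (ℚᵘ.≃-trans (*≡* cross)
  (ℚᵘ.≃-sym (ℚᵘ.≃-trans (ℚ.toℚᵘ-homo-* (j / suc N) (s / 1))
    (ℚᵘ.*-cong (ℚ.toℚᵘ-fromℚᵘ (mkℚᵘ j N)) (ℚ.toℚᵘ-fromℚᵘ (mkℚᵘ s 0)))))))
  where
  cross : v ℤ.* + suc (0 + N * 1) ≡ j ℤ.* s ℤ.* + 1
  cross = begin
    v ℤ.* + suc (N * 1)  ≡⟨ cong (λ k → v ℤ.* + suc k) (ℕ.*-identityʳ N) ⟩
    v ℤ.* + suc N        ≡⟨ ℤ.*-comm v (+ suc N) ⟩
    + suc N ℤ.* v        ≡⟨ eq ⟩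
    j ℤ.* s              ≡⟨ ℤ.*-identityʳ (j ℤ.* s) ⟨
    j ℤ.* s ℤ.* + 1      ∎

count-formula : ∀ n (2≤n : 2 ≤ n) j → j ≤ n ∸ 1 → + count n (suc j) / 1 ≡ visibilityFormula n j 2≤n
count-formula (suc (suc N)) (s≤s (s≤s _)) j j≤n-1 = fraction-equation N _ (+ j) _ (begin
  + suc N ℤ.* + count (2 + N) (suc j)
    ≡⟨ lagrange N j (suc N ∸ j) (ℕ.m+[n∸m]≡n j≤n-1) ⟩
  + j ℤ.* (power (suc N ∸ j) ℤ.* coefficient (suc N) (suc N ∸ j))
    ≡⟨ cong (λ s → + j ℤ.* (power (suc N ∸ j) ℤ.* s)) (Σ-summand N j (suc N ∸ j) (ℕ.m+[n∸m]≡n j≤n-1)) ⟨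
  _ ∎)

-- Transfer of cardinalities to the geometric statement

HasCardinality-cong : ∀ {a ℓ ℓ′} {A : Set a} {P : A → Set ℓ} {Q : A → Set ℓ′} {m} →
                      (∀ x → P x ⇔ Q x) → HasCardinality P m → HasCardinality Q m
HasCardinality-cong P⇔Q (xs , unique , xs⇔ , length≡) =
  xs , unique , (λ x → mk⇔ (to (P⇔Q x) ∘ to (xs⇔ x)) (from (xs⇔ x) ∘ from (P⇔Q x))) , length≡

-- Repetition-free lists with the same members are equal as bags, hence permutations of each other.
-- This makes the visibility degree well defined, so that it determines the weight.
HasCardinality-unique : ∀ {a ℓ} {A : Set a} {P : A → Set ℓ} {m n} →
                        HasCardinality P m → HasCardinality P n → m ≡ n
HasCardinality-unique (xs , unique-xs , xs⇔ , refl) (ys , unique-ys , ys⇔ , refl) =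
  ↭-length (∼bag⇒↭ (unique∧set⇒bag unique-xs unique-ys λ {x} →
    mk⇔ (from (ys⇔ x) ∘ to (xs⇔ x)) (from (xs⇔ x) ∘ to (ys⇔ x))))

noncrossing-cardinality : ∀ n k →
  HasCardinality (λ (G : Graph n) → NonCrossing G × k ≡ weight G) (count n k)
noncrossing-cardinality n k =
  filter has-weight (noncrossingGraphs n) ,
  Unique.filter⁺ has-weight (noncrossingGraphs-unique n) ,
  (λ G → mk⇔
    (λ G∈ → let G∈′ , eq = ∈-filter⁻ has-weight {xs = noncrossingGraphs n} G∈ in
      ∈-noncrossingGraphs⁻ G G∈′ , eq)
    (λ (nc , eq) → ∈-filter⁺ has-weight (∈-noncrossingGraphs⁺ G nc) eq)) ,
  length-filter weight k (noncrossingGraphs n)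
  where
  has-weight = λ (G : Graph n) → k ℕ.≟ weight G

module _ {c ℓ₁ ℓ₂} (F : OrderedField c ℓ₁ ℓ₂) where
  open Geometry F
  open PlaneGeometry F

  module _ {n} (p : Vec Point n) (q : Point)
           (convex : ConvexPosition (p ∷ʳ q)) (G : Graph n) where
    open ConvexGeometry p q convex G

    visible-cardinality : HasCardinality (λ i → Visible p G q (lookup p i)) (weight G)
    visible-cardinality = HasCardinality-cong
      (λ i → mk⇔ (from (visible⇔uncovered {i}) ∘ to (uncovered⇔ G i))
                 (from (uncovered⇔ G i) ∘ to (visible⇔uncovered {i})))
      (members (uncovered G) , members-unique (uncovered G) , ∈-members⇔ (uncovered G) ,
       length-members (uncovered G))

    degree⇔weight : ∀ d → HasRootVisibilityDegree p G q d ⇔ (d + 2 ≡ weight G)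
    degree⇔weight d = mk⇔
      (λ degree → HasCardinality-unique degree visible-cardinality)
      (λ eq → subst (HasCardinality (λ i → Visible p G q (lookup p i))) (sym eq) visible-cardinality)

    combinatorial⇔geometric : ∀ d →
      (NonCrossing G × d + 2 ≡ weight G) ⇔ (Plane p G × HasRootVisibilityDegree p G q d)
    combinatorial⇔geometric d = mk⇔
      (λ (nc , eq) → noncrossing⇒plane nc , from (degree⇔weight d) eq)
      (λ (plane , degree) → plane⇒noncrossing plane , to (degree⇔weight d) degree)

theorem9 : ∀ {c ℓ₁ ℓ₂} (F : OrderedField c ℓ₁ ℓ₂) → let open Geometry F in
    ∀ (n : ℕ) (2≤n : 2 ≤ n) (p : Vec Point n) (q : Point) → ConvexPosition (p ∷ʳ q) →
    ∀ (j : ℕ) → 1 ≤ j → j ≤ n ∸ 1 →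
    ∃[ v ] HasCardinality (λ (G : Graph n) → Plane p G × HasRootVisibilityDegree p G q (j ∸ 1)) v
    × + v / 1 ≡ visibilityFormula n j 2≤n
theorem9 F n 2≤n p q convex (suc j) _ j≤n-1 =
  -- Here `j` is already the degree, one less than in the statement, so `2 + j` vertices are
  -- visible.
  count n (2 + j) ,
  HasCardinality-cong (λ G → combinatorial⇔geometric F p q convex G j)
    (subst (λ k → HasCardinality (λ (G : Graph n) → NonCrossing G × k ≡ weight G) (count n (2 + j)))
      (ℕ.+-comm 2 j) (noncrossing-cardinality n (2 + j))) ,
  count-formula n 2≤n (suc j) j≤n-1
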